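{- The complete tripartite graphs $K_{1,1,1}$, $K_{1,1,2}$, $K_{1,2,2}$, $K_{2,2,2}$ and $K_{2,2,3}$ are $e$-positive, and every other complete tripartite graph $K_{r,s,t}$ ($1\le r\le s\le t$) is not Schur positive.
   Context: $K_{r,s,t}$ is the complete tripartite graph with parts of sizes $r,s,t$. The chromatic symmetric function of a graph $G$ is $X_G=\sum_{\kappa}\prod_{v\in V(G)}x_{\kappa(v)}$, summed over all proper colorings $\kappa:V(G)\to\{1,2,\dots\}$. $G$ is $e$-positive (resp. Schur positive) if all coefficients of $X_G$ in the elementary symmetric function basis $e_\lambda$ (resp. Schur function basis $s_\lambda$) are nonnegative. -}

module Defs where

open import Data.Bool using (Bool; true; false; _∧_; _∨_; not; if_then_else_)
open import Data.Nat using (ℕ; zero; suc; _+_; _*_; _≤_; _≥_; _<ᵇ_; _≡ᵇ_)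
open import Data.Fin using (Fin; toℕ)
open import Data.List using (List; []; _∷_; map; concatMap; allFin)
open import Data.Bool.ListAction using (and)
open import Data.Nat.ListAction using (sum)
open import Data.List.Relation.Unary.All using (All)
open import Data.List.Relation.Unary.Linked using (Linked)
open import Data.Vec using (Vec; []; _∷_; tabulate; lookup)
open import Data.Product using (Σ; _×_; _,_; proj₁; proj₂; ∃-syntax)
open import Relation.Binary.PropositionalEquality using (_≡_)

record Graph : Set where
  field
    n   : ℕ
    adj : Fin n → Fin n → Bool

part : (r s t : ℕ) → Fin (r + s + t) → ℕ
part r s t v = if toℕ v <ᵇ r then 0 else (if toℕ v <ᵇ (r + s) then 1 else 2)

K₃ : ℕ → ℕ → ℕ → Graph
K₃ r s t = record
  { n   = r + s + t
  ; adj = λ v w → not (part r s t v ≡ᵇ part r s t w) }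

vecsOf : {A : Set} → List A → (k : ℕ) → List (Vec A k)
vecsOf xs zero    = [] ∷ []
vecsOf xs (suc k) = concatMap (λ v → map (λ x → x ∷ v) xs) (vecsOf xs k)

listsOf : {A : Set} → List A → ℕ → List (List A)
listsOf xs zero    = [] ∷ []
listsOf xs (suc k) = concatMap (λ v → map (λ x → x ∷ v) xs) (listsOf xs k)

countᵇ : {A : Set} → (A → Bool) → List A → ℕ
countᵇ p []       = 0
countᵇ p (x ∷ xs) = (if p x then 1 else 0) + countᵇ p xs

_==F_ : {m : ℕ} → Fin m → Fin m → Bool
i ==F j = toℕ i ≡ᵇ toℕ j

_==V_ : {m : ℕ} → Vec ℕ m → Vec ℕ m → Bool
[] ==V [] = true
(x ∷ xs) ==V (y ∷ ys) = (x ≡ᵇ y) ∧ (xs ==V ys)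

b2n : Bool → ℕ
b2n true  = 1
b2n false = 0

-- Chromatic symmetric function, via its monomial coefficients.
-- For α = (α₁,…,α_m), XCoeff G α is the coefficient of x₁^α₁ ⋯ x_m^α_m in
-- X_G = Σ_κ Π_v x_{κ(v)}, i.e. the number of proper colourings
-- κ : V(G) → {1,…,m} using colour i exactly αᵢ times.

module _ (G : Graph) where
  open Graph G

  proper : {m : ℕ} → Vec (Fin m) n → Bool
  proper κ = and (concatMap (λ i → map (λ j →
                 not (adj i j) ∨ not (lookup κ i ==F lookup κ j)) (allFin n)) (allFin n))

  colourContent : {m : ℕ} → Vec (Fin m) n → Vec ℕ m
  colourContent {m} κ = tabulate (λ c → countᵇ (λ i → lookup κ i ==F c) (allFin n))

  XCoeff : {m : ℕ} → Vec ℕ m → ℕ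
  XCoeff {m} α = countᵇ (λ κ → proper κ ∧ (colourContent κ ==V α))
                        (vecsOf (allFin m) n)

IsPartition : List ℕ → Set
IsPartition λ′ = All (λ k → 1 ≤ k) λ′ × Linked _≥_ λ′

-- Elementary symmetric functions e_λ = Π_i e_{λᵢ},
-- e_k = Σ_{j₁<⋯<j_k} x_{j₁}⋯x_{j_k}.  Expanding the product, the
-- coefficient of x₁^α₁⋯x_m^α_m is the number of tuples (S₁,…,S_ℓ) of
-- subsets of {1,…,m} with |Sᵢ| = λᵢ such that every j lies in exactly αⱼ
-- of the Sᵢ.  Subsets of {1..m} are represented by Vec Bool m.

subsetsOfSize : (m k : ℕ) → List (Vec Bool m)
subsetsOfSize m k = Data.List.filterᵇ (λ S → countᵇ (λ b → b) (Data.Vec.toList S) ≡ᵇ k)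
                                       (vecsOf (true ∷ false ∷ []) m)
  where import Data.List

subsetTuples : (m : ℕ) → List ℕ → List (List (Vec Bool m))
subsetTuples m []       = [] ∷ []
subsetTuples m (k ∷ λ′) = concatMap (λ rest → map (λ S → S ∷ rest) (subsetsOfSize m k))
                                     (subsetTuples m λ′)

multiplicities : {m : ℕ} → List (Vec Bool m) → Vec ℕ m
multiplicities {m} Ss = tabulate (λ j → sum (map (λ S → b2n (lookup S j)) Ss))

eCoeff : List ℕ → {m : ℕ} → Vec ℕ m → ℕ
eCoeff λ′ {m} α = countᵇ (λ Ss → multiplicities Ss ==V α) (subsetTuples m λ′)

-- Schur functions s_λ = Σ_{T SSYT of shape λ} x^T.  The coefficient of
-- x₁^α₁⋯x_m^α_m is the number of semistandard Young tableaux of shape λ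
-- with entries in {1,…,m} (here Fin m) and content α: rows weakly
-- increasing, columns strictly increasing, value i occurring αᵢ times.
-- A filling is a list of rows, row i having length λᵢ.

fillings : (m : ℕ) → List ℕ → List (List (List (Fin m)))
fillings m []       = [] ∷ []
fillings m (k ∷ λ′) = concatMap (λ rest → map (λ row → row ∷ rest) (listsOf (allFin m) k))
                                 (fillings m λ′)

rowWeak : {m : ℕ} → List (Fin m) → Bool
rowWeak []           = true
rowWeak (x ∷ [])     = true
rowWeak (x ∷ y ∷ xs) = not (toℕ y <ᵇ toℕ x) ∧ rowWeak (y ∷ xs)

-- entrywise strict increase from an upper row to the row below it
-- (the lower row is no longer than the upper one for partition shapes)
colStrict : {m : ℕ} → List (Fin m) → List (Fin m) → Bool
colStrict upper       []          = true
colStrict []          (y ∷ ys)    = false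
colStrict (x ∷ xs)    (y ∷ ys)    = (toℕ x <ᵇ toℕ y) ∧ colStrict xs ys

isSSYT : {m : ℕ} → List (List (Fin m)) → Bool
isSSYT []                 = true
isSSYT (r ∷ [])           = rowWeak r
isSSYT (r ∷ r′ ∷ rs)      = rowWeak r ∧ colStrict r r′ ∧ isSSYT (r′ ∷ rs)

tableauContent : {m : ℕ} → List (List (Fin m)) → Vec ℕ m
tableauContent {m} T = tabulate (λ c → sum (map (countᵇ (λ x → x ==F c)) T))

sCoeff : List ℕ → {m : ℕ} → Vec ℕ m → ℕ
sCoeff λ′ {m} α = countᵇ (λ T → isSSYT T ∧ (tableauContent T ==V α)) (fillings m λ′)

combCoeff : List (List ℕ × ℕ) → (List ℕ → {m : ℕ} → Vec ℕ m → ℕ) →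
            {m : ℕ} → Vec ℕ m → ℕ
combCoeff []             b α = 0
combCoeff ((λ′ , c) ∷ L) b α = c * b λ′ α + combCoeff L b α

-- X_G equals a nonnegative combination of the basis b (equality of formal
-- power series: every monomial coefficient agrees, in any number of variables).
PositiveIn : (List ℕ → {m : ℕ} → Vec ℕ m → ℕ) → Graph → Set
PositiveIn b G = ∃[ L ] (All (λ p → IsPartition (proj₁ p)) L
                 × ((m : ℕ) (α : Vec ℕ m) → XCoeff G α ≡ combCoeff L b α))

EPositive : Graph → Set
EPositive = PositiveIn eCoeff

SchurPositive : Graph → Set
SchurPositive = PositiveIn sCoeff

data Exceptional : ℕ → ℕ → ℕ → Set where
  e111 : Exceptional 1 1 1
  e112 : Exceptional 1 1 2
  e122 : Exceptional 1 2 2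
  e222 : Exceptional 2 2 2
  e223 : Exceptional 2 2 3

{-# OPTIONS --safe #-}
-- Nonpositivity: if some semistandard tableau has content (p + 1, q, γ) with q ≤ p, then turning
-- the last 0 of its first row into 1 gives one of the same shape with content (p, q + 1, γ). So if
-- K_{r,s,t} is Schur positive and has a proper colouring of content (p + 1, q, γ), then it also has
-- one of content (p, q + 1, γ). This fails
--   for t ≥ r + 2              at (t, r, s, 0)     → (t - 1, r + 1, s, 0),
--   for K_{r,r,t}, r ≥ 3,      at (r, r - 2, t, 2) → (r - 1, r - 1, t, 2),
--   for K_{r,r+1,r+1}, r ≥ 2,  at (r + 1, 1, r, r) → (r, 2, r, r),
-- because the colour classes inside one part have to add up to the size of that part.
--
-- e-positivity: the coefficients on both sides vanish unless the exponents add up to the number of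
-- vertices, and do not change when zero exponents are dropped. An e-expansion is therefore verified
-- by evaluating both sides on the compositions of r + s + t.
module Submission where

open import Defs
open import Algebra.Properties.CommutativeSemigroup using (interchange; x∙yz≈y∙xz)
open import Data.Bool using (Bool; true; false; T; _∧_; _∨_; not; if_then_else_)
open import Data.Bool.ListAction using (and)
open import Data.Bool.Properties using (T-∧; ∧-zeroʳ)
open import Data.Empty using (⊥-elim)
open import Data.Fin using (Fin; zero; suc; toℕ)
open import Data.Fin.Patterns using (0F; 1F; 2F; 3F)
open import Data.Fin.Properties using (any?) renaming (_≟_ to _≟F_)
open import Data.List using (List; []; _∷_; _++_; map; concatMap; allFin; length)
import Data.List as List
open import Data.List.Membership.Propositional using (_∈_)
open import Data.List.Membership.Propositional.Properties
  using (∈-map⁺; ∈-map⁻; ∈-++⁺ˡ; ∈-++⁺ʳ; ∈-++⁻; ∈-allFin)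
open import Data.List.Properties using (map-cong)
open import Data.List.Relation.Unary.All as All using (All; []; _∷_)
open import Data.List.Relation.Unary.Any using (here; there)
open import Data.List.Relation.Unary.Linked using (linked?)
open import Data.Maybe using (Maybe; just; nothing)
open import Data.Nat using (ℕ; zero; suc; pred; _+_; _*_; _≤_; _<_; _<ᵇ_; _≡ᵇ_; z≤n; s≤s)
open import Data.Nat.ListAction using (sum)
open import Data.Nat.Properties
open import Data.Product using (_×_; _,_; proj₁; proj₂; ∃-syntax)
open import Data.Sum using (inj₁; inj₂)
open import Data.Unit using (⊤; tt)
open import Data.Vec using (Vec; []; _∷_; tabulate; lookup; updateAt)
import Data.Vec as Vec
open import Data.Vec.Properties using
  (tabulate-cong; lookup∘tabulate; tabulate∘lookup; lookup∘updateAt; lookup∘updateAt′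
  ; lookup-map; lookup-replicate; ∷-injective)
open import Function using (_∘_; _⇔_; mk⇔; Equivalence)
open import Relation.Binary.PropositionalEquality
open import Relation.Nullary using (¬_; Dec; yes; no; contradiction)
open import Relation.Nullary.Decidable using (True; toWitness; _×-dec_)
open Equivalence using (to; from)

private
  variable
    A B R : Set
    m n : ℕ

-- Counting

⟦_⟧ : Bool → ℕ
⟦ b ⟧ = if b then 1 else 0

∑ : (Fin n → ℕ) → ℕ
∑ f = Vec.sum (tabulate f)

∑-cong : {f g : Fin n → ℕ} → f ≗ g → ∑ f ≡ ∑ g
∑-cong f≗g = cong Vec.sum (tabulate-cong f≗g)

∑-+ : (f g : Fin n → ℕ) → ∑ (λ i → f i + g i) ≡ ∑ f + ∑ g
∑-+ {zero}  f g = refl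
∑-+ {suc n} f g = trans (cong (f zero + g zero +_) (∑-+ (f ∘ suc) (g ∘ suc)))
                        (interchange +-commutativeSemigroup (f zero) (g zero) _ _)

∑-zero : {f : Fin n → ℕ} → (∀ i → f i ≡ 0) → ∑ f ≡ 0
∑-zero {zero}  f≡0 = refl
∑-zero {suc n} f≡0 = cong₂ _+_ (f≡0 zero) (∑-zero (f≡0 ∘ suc))

sum-tabulate : (g : A → ℕ) (f : Fin n → A) → sum (map g (List.tabulate f)) ≡ ∑ (g ∘ f)
sum-tabulate {n = zero}  g f = refl
sum-tabulate {n = suc n} g f = cong (g (f zero) +_) (sum-tabulate g (f ∘ suc))

count-tabulate : (P : A → Bool) (f : Fin n → A) →
                 countᵇ P (List.tabulate f) ≡ ∑ (λ i → ⟦ P (f i) ⟧)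
count-tabulate {n = zero}  P f = refl
count-tabulate {n = suc n} P f = cong (⟦ P (f zero) ⟧ +_) (count-tabulate P (f ∘ suc))

count-cong : {P Q : A → Bool} → P ≗ Q → (xs : List A) → countᵇ P xs ≡ countᵇ Q xs
count-cong P≗Q []       = refl
count-cong P≗Q (x ∷ xs) = cong₂ (λ b k → ⟦ b ⟧ + k) (P≗Q x) (count-cong P≗Q xs)

count-false : (xs : List A) → countᵇ (λ _ → false) xs ≡ 0
count-false []       = refl
count-false (x ∷ xs) = count-false xs

count-map : (P : B → Bool) (f : A → B) (xs : List A) →
            countᵇ P (map f xs) ≡ countᵇ (P ∘ f) xs
count-map P f []       = refl
count-map P f (x ∷ xs) = cong (⟦ P (f x) ⟧ +_) (count-map P f xs)

count-++ : (P : A → Bool) (xs ys : List A) → countᵇ P (xs ++ ys) ≡ countᵇ P xs + countᵇ P ys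
count-++ P []       ys = refl
count-++ P (x ∷ xs) ys = trans (cong (⟦ P x ⟧ +_) (count-++ P xs ys))
                               (sym (+-assoc ⟦ P x ⟧ (countᵇ P xs) (countᵇ P ys)))

count-filter : (P Q : A → Bool) (xs : List A) →
               countᵇ P (List.filterᵇ Q xs) ≡ countᵇ (λ x → Q x ∧ P x) xs
count-filter P Q [] = refl
count-filter P Q (x ∷ xs) with Q x
... | true  = cong (⟦ P x ⟧ +_) (count-filter P Q xs)
... | false = count-filter P Q xs

-- `vecsOf`, `listsOf`, `fillings` and `subsetTuples` all enumerate by this `concatMap` of `map`, so
-- the same product form recurs for counting and, later, for membership.
count-product : (P : R → Bool) (h : A → B → R) (xs : List A) (ys : List B) →
                countᵇ P (concatMap (λ y → map (λ x → h x y) xs) ys)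
                ≡ sum (map (λ y → countᵇ (λ x → P (h x y)) xs) ys)
count-product P h xs []       = refl
count-product P h xs (y ∷ ys) = trans
  (count-++ P (map (λ x → h x y) xs) _)
  (cong₂ _+_ (count-map P (λ x → h x y) xs) (count-product P h xs ys))

sum-count-swap : (Q : A → B → Bool) (xs : List A) (ys : List B) →
                 sum (map (λ y → countᵇ (λ x → Q x y) xs) ys)
                 ≡ sum (map (λ x → countᵇ (Q x) ys) xs)
sum-count-swap Q [] ys = zeros ys
  where
  zeros : ∀ ys → sum (map (λ _ → 0) ys) ≡ 0
  zeros []       = refl
  zeros (_ ∷ ys) = zeros ys
sum-count-swap Q (x ∷ xs) ys = trans (split ys) (cong (countᵇ (Q x) ys +_) (sum-count-swap Q xs ys))
  where
  split : ∀ ys → sum (map (λ y → ⟦ Q x y ⟧ + countᵇ (λ x′ → Q x′ y) xs) ys)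
               ≡ countᵇ (Q x) ys + sum (map (λ y → countᵇ (λ x′ → Q x′ y) xs) ys)
  split []       = refl
  split (y ∷ ys) = trans (cong (⟦ Q x y ⟧ + countᵇ (λ x′ → Q x′ y) xs +_) (split ys))
                         (interchange +-commutativeSemigroup ⟦ Q x y ⟧ _ _ _)

-- `vecsOf` loops over the tails first; exchanging the two sums makes the first entry the outer
-- choice, as recursions along the vertices or the variables need.
count-vecsOf : (P : Vec A (suc n) → Bool) (xs : List A) →
               countᵇ P (vecsOf xs (suc n))
               ≡ sum (map (λ x → countᵇ (λ v → P (x ∷ v)) (vecsOf xs n)) xs)
count-vecsOf {n = n} P xs = trans (count-product P _∷_ xs (vecsOf xs n))
                                  (sum-count-swap (λ x v → P (x ∷ v)) xs (vecsOf xs n))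

count-positive : (P : A → Bool) {x : A} {xs : List A} → x ∈ xs → T (P x) → 1 ≤ countᵇ P xs
count-positive P {xs = x ∷ xs} (here refl)  Px with P x
... | true = s≤s z≤n
count-positive P {xs = y ∷ xs} (there x∈xs) Px =
  ≤-trans (count-positive P x∈xs Px) (m≤n+m _ ⟦ P y ⟧)

count-witness : (P : A → Bool) (xs : List A) → 1 ≤ countᵇ P xs → ∃[ x ] x ∈ xs × T (P x)
count-witness P (x ∷ xs) 1≤count with P x in Px
... | true  = x , here refl , subst T (sym Px) tt
... | false with count-witness P xs 1≤count
...   | y , y∈xs , Py = y , there y∈xs , Py

∈-product⁺ : (h : A → B → R) {xs : List A} {ys : List B} {x : A} {y : B} → x ∈ xs → y ∈ ys →
             h x y ∈ concatMap (λ y → map (λ x → h x y) xs) ys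
∈-product⁺ h {y = y} x∈xs (here refl)  = ∈-++⁺ˡ (∈-map⁺ (λ x → h x y) x∈xs)
∈-product⁺ h {xs} x∈xs (there {x = y} y∈ys) =
  ∈-++⁺ʳ (map (λ x → h x y) xs) (∈-product⁺ h x∈xs y∈ys)

vecsOf-complete : {xs : List A} → (∀ x → x ∈ xs) → (v : Vec A n) → v ∈ vecsOf xs n
vecsOf-complete all []      = here refl
vecsOf-complete all (x ∷ v) = ∈-product⁺ _∷_ (all x) (vecsOf-complete all v)

T-and-++ : (bs cs : List Bool) → T (and (bs ++ cs)) ⇔ (T (and bs) × T (and cs))
T-and-++ []           cs = mk⇔ (tt ,_) proj₂
T-and-++ (true  ∷ bs) cs = T-and-++ bs cs
T-and-++ (false ∷ bs) cs = mk⇔ (λ ()) proj₁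

T-and-tabulate : (p : A → Bool) (f : Fin n → A) →
                 T (and (map p (List.tabulate f))) ⇔ (∀ i → T (p (f i)))
T-and-tabulate {n = zero}  p f = mk⇔ (λ _ ()) (λ _ → tt)
T-and-tabulate {n = suc n} p f = mk⇔
  (λ t → λ { zero → proj₁ (to T-∧ t) ; (suc i) → to (T-and-tabulate p (f ∘ suc)) (proj₂ (to T-∧ t)) i })
  (λ h → from T-∧ (h zero , from (T-and-tabulate p (f ∘ suc)) (h ∘ suc)))

T-and-concatMap : (g : A → List Bool) (f : Fin n → A) →
                  T (and (concatMap g (List.tabulate f))) ⇔ (∀ i → T (and (g (f i))))
T-and-concatMap {n = zero}  g f = mk⇔ (λ _ ()) (λ _ → tt)
T-and-concatMap {n = suc n} g f = mk⇔
  (λ t → λ { zero → proj₁ (to (T-and-++ (g (f zero)) _) t)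
           ; (suc i) → to (T-and-concatMap g (f ∘ suc)) (proj₂ (to (T-and-++ (g (f zero)) _) t)) i })
  (λ h → from (T-and-++ (g (f zero)) _) (h zero , from (T-and-concatMap g (f ∘ suc)) (h ∘ suc)))

T-injective : {a b : Bool} → T a ⇔ T b → a ≡ b
T-injective {true}  {true}  _ = refl
T-injective {true}  {false} e = ⊥-elim (to e tt)
T-injective {false} {true}  e = ⊥-elim (from e tt)
T-injective {false} {false} _ = refl

≡ᵇ-refl : (k : ℕ) → (k ≡ᵇ k) ≡ true
≡ᵇ-refl zero    = refl
≡ᵇ-refl (suc k) = ≡ᵇ-refl k

==F-refl : (i : Fin m) → (i ==F i) ≡ true
==F-refl zero    = refl
==F-refl (suc i) = ==F-refl i

==F-≢ : {i j : Fin m} → i ≢ j → (i ==F j) ≡ false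
==F-≢ {i = zero}  {zero}  i≢j = contradiction refl i≢j
==F-≢ {i = zero}  {suc j} i≢j = refl
==F-≢ {i = suc i} {zero}  i≢j = refl
==F-≢ {i = suc i} {suc j} i≢j = ==F-≢ (i≢j ∘ cong suc)

==V⇒≡ : (u v : Vec ℕ m) → T (u ==V v) → u ≡ v
==V⇒≡ []      []      _ = refl
==V⇒≡ (x ∷ u) (y ∷ v) t with to T-∧ t
... | x≡y , u≡v = cong₂ _∷_ (≡ᵇ⇒≡ x y x≡y) (==V⇒≡ u v u≡v)

==V-refl : (u : Vec ℕ m) → T (u ==V u)
==V-refl []      = tt
==V-refl (x ∷ u) = from T-∧ (≡⇒≡ᵇ x x refl , ==V-refl u)

-- Proper colourings of complete multipartite graphs

multipartite : (Fin n → ℕ) → Graph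
multipartite {n} P = record { n = n ; adj = λ v w → not (P v ≡ᵇ P w) }

-- Vertices are nonadjacent exactly when they share a part, so this is properness: each colour class
-- lies inside one part.
Compatible : (Fin n → ℕ) → Vec (Fin m) n → Set
Compatible P κ = ∀ i j → lookup κ i ≡ lookup κ j → P i ≡ P j

occurrences : Vec (Fin m) n → Fin m → ℕ
occurrences κ c = ∑ (λ i → ⟦ lookup κ i ==F c ⟧)

HasContent : Vec (Fin m) n → Vec ℕ m → Set
HasContent κ α = ∀ c → occurrences κ c ≡ lookup α c

module _ (P : Fin n → ℕ) where

  isColouring : Vec ℕ m → Vec (Fin m) n → Bool
  isColouring α κ = proper (multipartite P) κ ∧ (colourContent (multipartite P) κ ==V α)

  proper⇔compatible : (κ : Vec (Fin m) n) → T (proper (multipartite P) κ) ⇔ Compatible P κ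
  proper⇔compatible κ = mk⇔
    (λ t i j → to (pair i j) (to (T-and-tabulate _ _) (to (T-and-concatMap _ _) t i) j))
    (λ h → from (T-and-concatMap _ _) λ i → from (T-and-tabulate _ _) λ j → from (pair i j) (h i j))
    where
    pair : ∀ i j → T (not (not (P i ≡ᵇ P j)) ∨ not (lookup κ i ==F lookup κ j))
                   ⇔ (lookup κ i ≡ lookup κ j → P i ≡ P j)
    pair i j with P i ≡ᵇ P j in eq
    ... | true  = mk⇔ (λ _ _ → ≡ᵇ⇒≡ (P i) (P j) (subst T (sym eq) tt)) (λ _ → tt)
    ... | false with lookup κ i ≟F lookup κ j
    ...   | no  κi≢κj rewrite ==F-≢ κi≢κj = mk⇔ (λ _ κi≡κj → contradiction κi≡κj κi≢κj) (λ _ → tt)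
    ...   | yes κi≡κj rewrite κi≡κj | ==F-refl (lookup κ j) =
      mk⇔ ⊥-elim (λ h → subst T (trans (sym (≡ᵇ-refl (P j))) (trans (cong (_≡ᵇ P j) (sym (h refl))) eq)) tt)

  content≡occurrences : (κ : Vec (Fin m) n) →
                        colourContent (multipartite P) κ ≡ tabulate (occurrences κ)
  content≡occurrences κ = tabulate-cong (λ c → count-tabulate (λ i → lookup κ i ==F c) (λ i → i))

  isColouring⇔ : (α : Vec ℕ m) (κ : Vec (Fin m) n) →
                 T (isColouring α κ) ⇔ (Compatible P κ × HasContent κ α)
  isColouring⇔ α κ = mk⇔ sound complete
    where
    sound : T (isColouring α κ) → Compatible P κ × HasContent κ α
    sound t with to T-∧ t
    ... | isProper , content = to (proper⇔compatible κ) isProper , λ c → begin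
        occurrences κ c                     ≡⟨ lookup∘tabulate (occurrences κ) c ⟨
        lookup (tabulate (occurrences κ)) c ≡⟨ cong (λ v → lookup v c) (content≡occurrences κ) ⟨
        lookup (colourContent (multipartite P) κ) c
          ≡⟨ cong (λ v → lookup v c) (==V⇒≡ (colourContent (multipartite P) κ) α content) ⟩
        lookup α c                          ∎
      where open ≡-Reasoning
    complete : Compatible P κ × HasContent κ α → T (isColouring α κ)
    complete (compatible , content) = from T-∧
      ( from (proper⇔compatible κ) compatible
      , subst (λ v → T (v ==V α))
          (trans (sym (tabulate∘lookup α)) (trans (tabulate-cong (sym ∘ content)) (sym (content≡occurrences κ))))
          (==V-refl α) )

  XCoeff-positive : (α : Vec ℕ m) (κ : Vec (Fin m) n) → Compatible P κ → HasContent κ α →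
                    1 ≤ XCoeff (multipartite P) α
  XCoeff-positive α κ compatible content =
    count-positive (isColouring α) (vecsOf-complete ∈-allFin κ)
      (from (isColouring⇔ α κ) (compatible , content))

  XCoeff-witness : (α : Vec ℕ m) → 1 ≤ XCoeff (multipartite P) α →
                   ∃[ κ ] Compatible P κ × HasContent κ α
  XCoeff-witness {m} α positive
    with κ , _ , t ← count-witness (isColouring α) (vecsOf (allFin m) n) positive
    = κ , to (isColouring⇔ α κ) t

∑-select : (c : Fin m) (f : Fin m → ℕ) → ∑ (λ d → if c ==F d then f d else 0) ≡ f c
∑-select {suc m} zero f = trans (cong (f zero +_) (∑-zero {m} {λ _ → 0} (λ _ → refl))) (+-identityʳ (f zero))
∑-select (suc c) f = ∑-select c (f ∘ suc)

∑-swap : (f : Fin m → Fin n → ℕ) → ∑ (λ i → ∑ (f i)) ≡ ∑ (λ j → ∑ (λ i → f i j))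
∑-swap {zero} {n} f = sym (∑-zero {n} {λ _ → 0} (λ _ → refl))
∑-swap {suc m} {n} f = trans (cong (∑ (f zero) +_) (∑-swap (f ∘ suc)))
                         (sym (∑-+ (f zero) (λ j → ∑ (λ i → f (suc i) j))))

-- An unused colour gets the junk owner 0.
owner-of : (P : Fin n → ℕ) (κ : Vec (Fin m) n) → Compatible P κ → (c : Fin m) →
           ∃[ o ] (∀ i → lookup κ i ≡ c → P i ≡ o)
owner-of P κ compatible c with any? (λ i → lookup κ i ≟F c)
... | yes (j , κj≡c) = P j , λ i κi≡c → compatible i j (trans κi≡c (sym κj≡c))
... | no  unused     = 0 , λ i κi≡c → contradiction (i , κi≡c) unused

part-size : (P : Fin n → ℕ) (κ : Vec (Fin m) n) (α : Vec ℕ m) →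
            Compatible P κ → HasContent κ α →
            ∃[ owner ] (∀ p → ∑ (λ i → ⟦ P i ≡ᵇ p ⟧)
                              ≡ ∑ (λ c → if owner c ≡ᵇ p then lookup α c else 0))
part-size {n} {m} P κ α compatible content = owner , size
  where
  open ≡-Reasoning
  owner : Fin m → ℕ
  owner c = proj₁ (owner-of P κ compatible c)
  -- If vertex `i` has colour `c`, its part is `owner c`; otherwise both sides are 0. This moves the
  -- test from the vertex to its colour.
  term : ∀ p i c → (if lookup κ i ==F c then ⟦ P i ≡ᵇ p ⟧ else 0)
                   ≡ (if owner c ≡ᵇ p then ⟦ lookup κ i ==F c ⟧ else 0)
  term p i c with lookup κ i ≟F c
  ... | yes κi≡c rewrite proj₂ (owner-of P κ compatible c) i κi≡c | κi≡c | ==F-refl c = refl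
  ... | no  κi≢c rewrite ==F-≢ κi≢c with owner c ≡ᵇ p
  ...   | true  = refl
  ...   | false = refl
  collect : ∀ b c → ∑ (λ i → if b then ⟦ lookup κ i ==F c ⟧ else 0) ≡ (if b then lookup α c else 0)
  collect true  c = content c
  collect false c = ∑-zero {n} {λ _ → 0} (λ _ → refl)
  size : ∀ p → ∑ (λ i → ⟦ P i ≡ᵇ p ⟧) ≡ ∑ (λ c → if owner c ≡ᵇ p then lookup α c else 0)
  size p = begin
    ∑ (λ i → ⟦ P i ≡ᵇ p ⟧)
      ≡⟨ ∑-cong (λ i → ∑-select (lookup κ i) (λ _ → ⟦ P i ≡ᵇ p ⟧)) ⟨
    ∑ (λ i → ∑ (λ c → if lookup κ i ==F c then ⟦ P i ≡ᵇ p ⟧ else 0))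
      ≡⟨ ∑-cong (λ i → ∑-cong (term p i)) ⟩
    ∑ (λ i → ∑ (λ c → if owner c ≡ᵇ p then ⟦ lookup κ i ==F c ⟧ else 0))
      ≡⟨ ∑-swap (λ i c → if owner c ≡ᵇ p then ⟦ lookup κ i ==F c ⟧ else 0) ⟩
    ∑ (λ c → ∑ (λ i → if owner c ≡ᵇ p then ⟦ lookup κ i ==F c ⟧ else 0))
      ≡⟨ ∑-cong (λ c → collect (owner c ≡ᵇ p) c) ⟩
    ∑ (λ c → if owner c ≡ᵇ p then lookup α c else 0) ∎

-- Semistandard tableaux

IsTableau : List ℕ → Vec ℕ m → List (List (Fin m)) → Set
IsTableau λ′ α T′ = map length T′ ≡ λ′ × T (isSSYT T′) × tableauContent T′ ≡ α

listsOf-complete : {xs : List A} → (∀ x → x ∈ xs) → (v : List A) → v ∈ listsOf xs (length v)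
listsOf-complete all []      = here refl
listsOf-complete all (x ∷ v) = ∈-product⁺ _∷_ (all x) (listsOf-complete all v)

fillings-complete : (F : List (List (Fin m))) → F ∈ fillings m (map length F)
fillings-complete []        = here refl
fillings-complete (row ∷ F) = ∈-product⁺ _∷_ (listsOf-complete ∈-allFin row) (fillings-complete F)

∈-product⁻ : (h : A → B → R) (xs : List A) (ys : List B) {z : R} →
             z ∈ concatMap (λ y → map (λ x → h x y) xs) ys →
             ∃[ x ] ∃[ y ] x ∈ xs × y ∈ ys × z ≡ h x y
∈-product⁻ h xs (y ∷ ys) z∈ with ∈-++⁻ (map (λ x → h x y) xs) z∈
... | inj₁ z∈row with x , x∈xs , z≡ ← ∈-map⁻ (λ x → h x y) z∈row = x , y , x∈xs , here refl , z≡
... | inj₂ z∈rest with x , y′ , x∈xs , y∈ys , z≡ ← ∈-product⁻ h xs ys z∈rest =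
  x , y′ , x∈xs , there y∈ys , z≡

listsOf-length : (xs : List A) (k : ℕ) {v : List A} → v ∈ listsOf xs k → length v ≡ k
listsOf-length xs zero    (here refl) = refl
listsOf-length xs (suc k) v∈ with ∈-product⁻ _∷_ xs (listsOf xs k) v∈
... | x , w , _ , w∈ , refl = cong suc (listsOf-length xs k w∈)

fillings-shape : (λ′ : List ℕ) {F : List (List (Fin m))} → F ∈ fillings m λ′ → map length F ≡ λ′
fillings-shape []       (here refl) = refl
fillings-shape {m} (k ∷ λ′) F∈ with ∈-product⁻ _∷_ (listsOf (allFin m) k) (fillings m λ′) F∈
... | row , F , row∈ , F∈′ , refl = cong₂ _∷_ (listsOf-length (allFin m) k row∈) (fillings-shape λ′ F∈′)

sCoeff-witness : (λ′ : List ℕ) (α : Vec ℕ m) → 1 ≤ sCoeff λ′ α → ∃[ F ] IsTableau λ′ α F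
sCoeff-witness {m} λ′ α positive
  with F , F∈ , t ← count-witness (λ T → isSSYT T ∧ (tableauContent T ==V α)) (fillings m λ′) positive
  = F , fillings-shape λ′ F∈ , proj₁ (to T-∧ t) , ==V⇒≡ (tableauContent F) α (proj₂ (to (T-∧ {isSSYT F}) t))

sCoeff-positive : {λ′ : List ℕ} {α : Vec ℕ m} (F : List (List (Fin m))) →
                  IsTableau λ′ α F → 1 ≤ sCoeff λ′ α
sCoeff-positive {m} F (refl , ssyt , refl) =
  count-positive (λ T → isSSYT T ∧ (tableauContent T ==V tableauContent F)) (fillings-complete F)
    (from T-∧ (ssyt , ==V-refl (tableauContent F)))

-- Raising a 0 of the first row to 1.

infix 7 _#_
_#_ : Fin m → List (Fin m) → ℕ
c # row = countᵇ (λ x → x ==F c) row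

pattern 2+ i = suc (suc i)

-- The last 0 of the leading run becomes 1. In a weakly increasing row this is the last 0 of all;
-- raising an earlier one would put a 1 before a 0.
promote : List (Fin (2 + m)) → List (Fin (2 + m))
promote []             = []
promote (0F ∷ [])      = 1F ∷ []
promote (0F ∷ 0F ∷ xs) = 0F ∷ promote (0F ∷ xs)
promote (0F ∷ suc y ∷ xs) = 1F ∷ suc y ∷ xs
promote (suc y ∷ xs)   = suc y ∷ xs

promote-length : (row : List (Fin (2 + m))) → length (promote row) ≡ length row
promote-length []             = refl
promote-length (0F ∷ [])      = refl
promote-length (0F ∷ 0F ∷ xs) = cong suc (promote-length (0F ∷ xs))
promote-length (0F ∷ suc y ∷ xs) = refl
promote-length (suc y ∷ xs)   = refl

promote-weak : (row : List (Fin (2 + m))) → T (rowWeak row) → T (rowWeak (promote row))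
promote-weak []             w = w
promote-weak (0F ∷ [])      w = tt
-- Nothing is below 0, so a 0 may be put in front of any weakly increasing row; the split only lets
-- `rowWeak` compute.
promote-weak (0F ∷ 0F ∷ xs) w with promote (0F ∷ xs) | promote-weak (0F ∷ xs) w
... | []     | w′ = tt
... | _ ∷ _  | w′ = w′
promote-weak (0F ∷ suc y ∷ xs) w = w
promote-weak (suc y ∷ xs)   w = w

weak-no-0 : (y : Fin (suc m)) (xs : List (Fin (2 + m))) → T (rowWeak (suc y ∷ xs)) → 0F # xs ≡ 0
weak-no-0 y []           w = refl
weak-no-0 y (suc z ∷ xs) w = weak-no-0 z xs (proj₂ (to T-∧ w))

weak-no-1 : (y : Fin m) (xs : List (Fin (2 + m))) → T (rowWeak (2+ y ∷ xs)) → 1F # xs ≡ 0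
weak-no-1 y []            w = refl
weak-no-1 y (2+ z ∷ xs)   w = weak-no-1 z xs (proj₂ (to T-∧ w))

promote-0# : (row : List (Fin (2 + m))) → T (rowWeak row) → 1 ≤ 0F # row →
             suc (0F # promote row) ≡ 0F # row
promote-0# (0F ∷ [])      w 1≤ = refl
promote-0# (0F ∷ 0F ∷ xs) w 1≤ = cong suc (promote-0# (0F ∷ xs) w (s≤s z≤n))
promote-0# (0F ∷ suc y ∷ xs) w 1≤ = refl
promote-0# (suc y ∷ xs)   w 1≤ = contradiction (subst (1 ≤_) (weak-no-0 y xs w) 1≤) (λ ())

promote-1# : (row : List (Fin (2 + m))) → T (rowWeak row) → 1 ≤ 0F # row →
             1F # promote row ≡ suc (1F # row)
promote-1# (0F ∷ [])      w 1≤ = refl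
promote-1# (0F ∷ 0F ∷ xs) w 1≤ = promote-1# (0F ∷ xs) w (s≤s z≤n)
promote-1# (0F ∷ suc y ∷ xs) w 1≤ = refl
promote-1# (suc y ∷ xs)   w 1≤ = contradiction (subst (1 ≤_) (weak-no-0 y xs w) 1≤) (λ ())

promote-2+# : (row : List (Fin (2 + m))) (c : Fin m) → 2+ c # promote row ≡ 2+ c # row
promote-2+# []             c = refl
promote-2+# (0F ∷ [])      c = refl
promote-2+# (0F ∷ 0F ∷ xs) c = promote-2+# (0F ∷ xs) c
promote-2+# (0F ∷ suc y ∷ xs) c = refl
promote-2+# (suc y ∷ xs)   c = refl

weak-tail : (y : Fin m) (ys : List (Fin m)) → T (rowWeak (y ∷ ys)) → T (rowWeak ys)
weak-tail y []       w = tt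
weak-tail y (z ∷ ys) w = proj₂ (to T-∧ w)

-- Below a 0 only positive entries stand, so the 1s of `lower` come first. Being fewer than the 0s
-- of `upper`, they end before the column of the last 0, and the entry below that 0 is at least 2 or
-- absent. The induction removes one column at a time.
promote-colStrict : (upper lower : List (Fin (2 + m))) → T (rowWeak upper) → T (rowWeak lower) →
                    T (colStrict upper lower) → 1F # lower < 0F # upper →
                    T (colStrict (promote upper) lower)
promote-colStrict upper [] _ _ _ _ = colStrict-[] (promote upper)
  where
  colStrict-[] : (u : List (Fin (suc (suc m)))) → T (colStrict u [])
  colStrict-[] []      = tt
  colStrict-[] (_ ∷ _) = tt
promote-colStrict (0F ∷ [])      (1F ∷ [])    _ _ _ (s≤s ())
promote-colStrict (0F ∷ [])      (2+ y ∷ [])  _ _ _ _ = tt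
promote-colStrict (0F ∷ 0F ∷ xs) (1F ∷ ys)    wu wl c (s≤s lt) =
  promote-colStrict (0F ∷ xs) ys wu (weak-tail 1F ys wl) c lt
-- After an entry of at least 2 no 1 follows in `lower`, while a 0 remains in `upper`, so the
-- inequality for the tails is immediate.
promote-colStrict (0F ∷ 0F ∷ xs) (2+ y ∷ ys)  wu wl c lt =
  promote-colStrict (0F ∷ xs) ys wu (weak-tail (2+ y) ys wl) c
    (subst (_< suc (0F # xs)) (sym (weak-no-1 y ys wl)) (s≤s z≤n))
promote-colStrict (0F ∷ suc x ∷ xs) (1F ∷ ys)   wu wl c (s≤s lt) =
  contradiction (subst (suc (1F # ys) ≤_) (weak-no-0 x xs wu) lt) (λ ())
promote-colStrict (0F ∷ suc x ∷ xs) (2+ y ∷ ys) wu wl c lt = c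
promote-colStrict (suc x ∷ xs) (y ∷ ys) wu wl c lt = c

colStrict-no-0 : (upper lower : List (Fin (suc m))) → T (colStrict upper lower) → 0F # lower ≡ 0
colStrict-no-0 upper    []           c = refl
colStrict-no-0 (x ∷ xs) (0F ∷ ys)    c = ⊥-elim (proj₁ (to (T-∧ {toℕ x <ᵇ 0} {colStrict xs ys}) c))
colStrict-no-0 (x ∷ xs) (suc y ∷ ys) c =
  colStrict-no-0 xs ys (proj₂ (to (T-∧ {toℕ x <ᵇ suc (toℕ y)}) c))

first-weak : (row : List (Fin m)) (rows : List (List (Fin m))) →
             T (isSSYT (row ∷ rows)) → T (rowWeak row)
first-weak row []         t = t
first-weak row (_ ∷ rows) t = proj₁ (to T-∧ t)

rest-SSYT : (row : List (Fin m)) (rows : List (List (Fin m))) →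
            T (isSSYT (row ∷ rows)) → T (isSSYT rows)
rest-SSYT row []            t = tt
rest-SSYT row (row′ ∷ rows) t = proj₂ (to (T-∧ {colStrict row row′}) (proj₂ (to (T-∧ {rowWeak row}) t)))

-- Columns increase strictly, so 0s stand only in the first row, and the content of 0 can be read
-- off that row.
lower-no-0 : (row : List (Fin (suc m))) (rows : List (List (Fin (suc m)))) →
             T (isSSYT (row ∷ rows)) → sum (map (0F #_) rows) ≡ 0
lower-no-0 row []            t = refl
lower-no-0 row (row′ ∷ rows) t = cong₂ _+_
  (colStrict-no-0 row row′ (proj₁ (to (T-∧ {colStrict row row′}) (proj₂ (to (T-∧ {rowWeak row}) t)))))
  (lower-no-0 row′ rows (rest-SSYT row (row′ ∷ rows) t))

promote-SSYT : (row : List (Fin (2 + m))) (rows : List (List (Fin (2 + m)))) →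
               T (isSSYT (row ∷ rows)) → sum (map (1F #_) rows) < 0F # row →
               T (isSSYT (promote row ∷ rows))
promote-SSYT row []            t lt = promote-weak row t
promote-SSYT row (row′ ∷ rows) t lt with to (T-∧ {rowWeak row}) t
... | w , cs with to (T-∧ {colStrict row row′}) cs
...   | c , s = from T-∧
  ( promote-weak row w
  , from T-∧ (promote-colStrict row row′ w (first-weak row′ rows s) c
                (≤-<-trans (m≤m+n (1F # row′) _) lt) , s) )

-- As the tableau has more 0s than 1s, the entry below the promoted 0, if any, is at least 2.
transfer : {λ′ : List ℕ} {p q : ℕ} {γ : Vec ℕ m} → q ≤ p →
           ∃[ F ] IsTableau λ′ (suc p ∷ q ∷ γ) F → ∃[ F ] IsTableau λ′ (p ∷ suc q ∷ γ) F
transfer {m} {p = p} {q} {γ} q≤p (row ∷ rows , shape , ssyt , content) =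
  promote row ∷ rows ,
  trans (cong (_∷ map length rows) (promote-length row)) shape ,
  -- At most `q` 1s lie below the first row, and `q ≤ p`, so they are fewer than the `suc p` 0s in
  -- it.
  promote-SSYT row rows ssyt (subst (sum (map (1F #_) rows) <_) (sym zeros) (s≤s (≤-trans ones≤q q≤p))) ,
  cong₂ _∷_ content₀ (cong₂ _∷_ content₁ content₂)
  where
  weak : T (rowWeak row)
  weak = first-weak row rows ssyt
  total : Fin (2 + m) → ℕ
  total c = c # row + sum (map (c #_) rows)
  zeros : 0F # row ≡ suc p
  zeros = trans (sym (trans (cong (0F # row +_) (lower-no-0 row rows ssyt)) (+-identityʳ _)))
                (proj₁ (∷-injective content))
  ones : total 1F ≡ q
  ones = proj₁ (∷-injective (proj₂ (∷-injective content)))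
  ones≤q : sum (map (1F #_) rows) ≤ q
  ones≤q = subst (sum (map (1F #_) rows) ≤_) ones (m≤n+m _ (1F # row))
  nonempty : 1 ≤ 0F # row
  nonempty = subst (1 ≤_) (sym zeros) (s≤s z≤n)
  content₀ : 0F # promote row + sum (map (0F #_) rows) ≡ p
  content₀ = suc-injective (trans (cong (_+ sum (map (0F #_) rows)) (promote-0# row weak nonempty))
                                  (proj₁ (∷-injective content)))
  content₁ : 1F # promote row + sum (map (1F #_) rows) ≡ suc q
  content₁ = trans (cong (_+ sum (map (1F #_) rows)) (promote-1# row weak nonempty)) (cong suc ones)
  content₂ : tabulate (λ c → 2+ c # promote row + sum (map (2+ c #_) rows)) ≡ γ
  content₂ = trans (tabulate-cong (λ c → cong (_+ sum (map (2+ c #_) rows)) (promote-2+# row c)))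
                   (proj₂ (∷-injective (proj₂ (∷-injective content))))

-- With natural numbers as coefficients nothing cancels: a term that is positive at `β` is positive
-- at `α`, and then so is the whole sum.
combCoeff-positive : (L : List (List ℕ × ℕ)) (b : List ℕ → {m : ℕ} → Vec ℕ m → ℕ)
                     (α β : Vec ℕ m) → (∀ λ′ → 1 ≤ b λ′ β → 1 ≤ b λ′ α) →
                     1 ≤ combCoeff L b β → 1 ≤ combCoeff L b α
combCoeff-positive ((λ′ , c) ∷ L) b α β mono 1≤ with b λ′ β in eq
... | zero  = ≤-trans (combCoeff-positive L b α β mono
                         (subst (λ x → 1 ≤ x + combCoeff L b β) (*-zeroʳ c) 1≤))
                      (m≤n+m _ (c * b λ′ α))
... | suc k with c
...   | zero   = combCoeff-positive L b α β mono 1≤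
...   | suc c′ = ≤-trans (mono λ′ (subst (1 ≤_) (sym eq) (s≤s z≤n)))
                   (≤-trans (m≤m+n (b λ′ α) _) (m≤m+n (suc c′ * b λ′ α) _))

-- Only the supports of the coefficients are compared, so the bare existence of tableaux and of
-- colourings suffices and no exact count is needed.
SchurPositive-transfer : {G : Graph} {p q : ℕ} (γ : Vec ℕ m) → SchurPositive G → q ≤ p →
                         1 ≤ XCoeff G (suc p ∷ q ∷ γ) → 1 ≤ XCoeff G (p ∷ suc q ∷ γ)
SchurPositive-transfer {p = p} {q} γ (L , _ , X≡) q≤p positive =
  subst (1 ≤_) (sym (X≡ _ (p ∷ suc q ∷ γ)))
    (combCoeff-positive L sCoeff (p ∷ suc q ∷ γ) (suc p ∷ q ∷ γ) step
      (subst (1 ≤_) (X≡ _ (suc p ∷ q ∷ γ)) positive))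
  where
  step : ∀ λ′ → 1 ≤ sCoeff λ′ (suc p ∷ q ∷ γ) → 1 ≤ sCoeff λ′ (p ∷ suc q ∷ γ)
  step λ′ 1≤ with F , tableau ← transfer q≤p (sCoeff-witness λ′ (suc p ∷ q ∷ γ) 1≤)
    = sCoeff-positive F tableau

-- Complete tripartite graphs

-- One encoding serves both for the part function, with values 0, 1, 1, 2, and for the colourings
-- constant on four consecutive blocks of vertices.
blocks : (r s₁ s₂ t : ℕ) (a b c d : A) → Vec A (r + (s₁ + s₂) + t)
blocks r s₁ s₂ t a b c d =
  (Vec.replicate r a Vec.++ (Vec.replicate s₁ b Vec.++ Vec.replicate s₂ c)) Vec.++ Vec.replicate t d

lookup-blocks-part : (r s₁ s₂ t : ℕ) (i : Fin (r + (s₁ + s₂) + t)) →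
                     part r (s₁ + s₂) t i ≡ lookup (blocks r s₁ s₂ t 0 1 1 2) i
lookup-blocks-part zero    zero     zero     t i       = sym (lookup-replicate i 2)
lookup-blocks-part zero    zero     (suc s₂) t zero    = refl
lookup-blocks-part zero    zero     (suc s₂) t (suc i) = lookup-blocks-part zero zero s₂ t i
lookup-blocks-part zero    (suc s₁) s₂       t zero    = refl
lookup-blocks-part zero    (suc s₁) s₂       t (suc i) = lookup-blocks-part zero s₁ s₂ t i
lookup-blocks-part (suc r) s₁       s₂       t zero    = refl
lookup-blocks-part (suc r) s₁       s₂       t (suc i) = lookup-blocks-part r s₁ s₂ t i

lookup-blocks : (f : A → B) (r s₁ s₂ t : ℕ) (a b c d : A) (i : Fin (r + (s₁ + s₂) + t)) →
                f (lookup (blocks r s₁ s₂ t a b c d) i)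
                ≡ lookup (blocks r s₁ s₂ t (f a) (f b) (f c) (f d)) i
lookup-blocks f zero    zero     zero     t a b c d i       =
  trans (cong f (lookup-replicate i d)) (sym (lookup-replicate i (f d)))
lookup-blocks f zero    zero     (suc s₂) t a b c d zero    = refl
lookup-blocks f zero    zero     (suc s₂) t a b c d (suc i) = lookup-blocks f zero zero s₂ t a b c d i
lookup-blocks f zero    (suc s₁) s₂       t a b c d zero    = refl
lookup-blocks f zero    (suc s₁) s₂       t a b c d (suc i) = lookup-blocks f zero s₁ s₂ t a b c d i
lookup-blocks f (suc r) s₁       s₂       t a b c d zero    = refl
lookup-blocks f (suc r) s₁       s₂       t a b c d (suc i) = lookup-blocks f r s₁ s₂ t a b c d i

tally : (A → Bool) → Vec A n → ℕ
tally P xs = ∑ (λ i → ⟦ P (lookup xs i) ⟧)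

tally-++ : (P : A → Bool) (xs : Vec A m) (ys : Vec A n) →
           tally P (xs Vec.++ ys) ≡ tally P xs + tally P ys
tally-++ P []       ys = refl
tally-++ P (x ∷ xs) ys = trans (cong (⟦ P x ⟧ +_) (tally-++ P xs ys))
                               (sym (+-assoc ⟦ P x ⟧ (tally P xs) (tally P ys)))

tally-replicate : (P : A → Bool) (k : ℕ) (a : A) →
                  tally P (Vec.replicate k a) ≡ (if P a then k else 0)
tally-replicate P zero a with P a
... | true  = refl
... | false = refl
tally-replicate P (suc k) a rewrite tally-replicate P k a with P a
... | true  = refl
... | false = refl

tally-blocks : (P : A → Bool) (r s₁ s₂ t : ℕ) (a b c d : A) →
               tally P (blocks r s₁ s₂ t a b c d)
               ≡ ((if P a then r else 0) + ((if P b then s₁ else 0) + (if P c then s₂ else 0)))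
                 + (if P d then t else 0)
tally-blocks P r s₁ s₂ t a b c d
  rewrite tally-++ P (Vec.replicate r a Vec.++ (Vec.replicate s₁ b Vec.++ Vec.replicate s₂ c))
                     (Vec.replicate t d)
        | tally-++ P (Vec.replicate r a) (Vec.replicate s₁ b Vec.++ Vec.replicate s₂ c)
        | tally-++ P (Vec.replicate s₁ b) (Vec.replicate s₂ c)
        | tally-replicate P r a | tally-replicate P s₁ b | tally-replicate P s₂ c
        | tally-replicate P t d = refl

-- The middle two blocks subdivide the second part.
blocks-colouring : (r s₁ s₂ t : ℕ) (a b c d : Fin m) (partOf : Fin m → ℕ) →
                   partOf a ≡ 0 → partOf b ≡ 1 → partOf c ≡ 1 → partOf d ≡ 2 → (α : Vec ℕ m) →
                   (∀ e → ((if a ==F e then r else 0)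
                             + ((if b ==F e then s₁ else 0) + (if c ==F e then s₂ else 0)))
                          + (if d ==F e then t else 0) ≡ lookup α e) →
                   1 ≤ XCoeff (K₃ r (s₁ + s₂) t) α
blocks-colouring r s₁ s₂ t a b c d partOf a↦0 b↦1 c↦1 d↦2 α content =
  XCoeff-positive (part r (s₁ + s₂) t) α κ compatible
    (λ e → trans (tally-blocks (_==F e) r s₁ s₂ t a b c d) (content e))
  where
  κ = blocks r s₁ s₂ t a b c d
  -- `partOf` sends each colour to the part where it is used. So the part of a vertex is a function
  -- of its colour, which gives compatibility.
  part≡ : ∀ i → part r (s₁ + s₂) t i ≡ partOf (lookup κ i)
  part≡ i = trans (lookup-blocks-part r s₁ s₂ t i) (trans
    (sym (cong₂ (λ (x , y) (z , w) → lookup (blocks r s₁ s₂ t x y z w) i)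
                (cong₂ _,_ a↦0 b↦1) (cong₂ _,_ c↦1 d↦2)))
    (sym (lookup-blocks partOf r s₁ s₂ t a b c d i)))
  compatible : Compatible (part r (s₁ + s₂) t) κ
  compatible i j κi≡κj = trans (part≡ i) (trans (cong partOf κi≡κj) (sym (part≡ j)))

-- The vanishing summand is the empty block in front of the second part in lookup-blocks-part r 0 s t.
Owners : (r s t : ℕ) → Vec ℕ m → (Fin m → ℕ) → Set
Owners r s t α owner =
  ∀ p → ((if 0 ≡ᵇ p then r else 0) + ((if 1 ≡ᵇ p then 0 else 0) + (if 1 ≡ᵇ p then s else 0)))
          + (if 2 ≡ᵇ p then t else 0)
        ≡ ∑ (λ c → if owner c ≡ᵇ p then lookup α c else 0)

-- Only arithmetic is kept of the colouring: the contents split into groups with sums `r`, `s` and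
-- `t`, a condition that a finite case analysis can refute.
colour-owners : (r s t : ℕ) (α : Vec ℕ m) → 1 ≤ XCoeff (K₃ r s t) α → ∃[ owner ] Owners r s t α owner
colour-owners r s t α positive
  with κ , compatible , content ← XCoeff-witness (part r s t) α positive
  with owner , size ← part-size (part r s t) κ α compatible content
  = owner , λ p → trans
      (sym (trans (∑-cong (λ i → cong (λ x → ⟦ x ≡ᵇ p ⟧) (lookup-blocks-part r 0 s t i)))
                  (tally-blocks (_≡ᵇ p) r 0 s t 0 1 1 2)))
      (size p)

-- The common frame of the three families: the transfer would yield a colouring whose classes cannot
-- be distributed over the parts.
not-Schur-positive-if : (r s t p q : ℕ) (γ : Vec ℕ m) → q ≤ p →
                        1 ≤ XCoeff (K₃ r s t) (suc p ∷ q ∷ γ) →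
                        (∀ owner → ¬ Owners r s t (p ∷ suc q ∷ γ) owner) →
                        ¬ SchurPositive (K₃ r s t)
not-Schur-positive-if r s t p q γ q≤p positive unowned schur =
  let owner , owned = colour-owners r s t (p ∷ suc q ∷ γ)
                        (SchurPositive-transfer {G = K₃ r s t} γ schur q≤p positive)
  in unowned owner owned

-- The three families that are not Schur positive.

≡ᵇ-exclusive : (k : ℕ) {p q : ℕ} → p ≢ q → (k ≡ᵇ p) ≡ true → (k ≡ᵇ q) ≡ false
≡ᵇ-exclusive k {p} {q} p≢q k≡p with k ≡ᵇ q in k≡q
... | false = refl
... | true  = contradiction (trans (sym (≡ᵇ⇒≡ k p (subst T (sym k≡p) tt)))
                                   (≡ᵇ⇒≡ k q (subst T (sym k≡q) tt))) p≢q

-- A part of size `suc k` that owns a class of size `k` has exactly one vertex left over; in the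
-- case checks below, the other classes it owns never add up to 1.
excess-1 : (k : ℕ) {x : ℕ} → suc k ≡ k + x → x ≡ 1
excess-1 k {x} eq = +-cancelˡ-≡ k x 1 (trans (sym eq) (+-comm 1 k))

-- After the transfer the classes have sizes `t`, `suc r`, `s` and 0. The part of size `r` is too
-- small for the first two, so it owns the class of size `s`. The part of size `suc t` is left with
-- `t` and `suc r`, but neither of them nor their sum is `suc t`, as `1 ≤ r` and `r < t`.
far-apart : (r s t : ℕ) → 1 ≤ r → r < t → ¬ SchurPositive (K₃ r s (suc t))
far-apart r s t 1≤r r<t =
  not-Schur-positive-if r s (suc t) t r (s ∷ 0 ∷ []) (<⇒≤ r<t)
      (blocks-colouring r 0 s (suc t) 1F 2F 2F 0F
        -- Colours 0, 1, 2 fill the parts of sizes `suc t`, `r`, `s`. Colour 3 occurs at no vertex,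
        -- so its entry is a filler.
        (lookup (2 ∷ 0 ∷ 1 ∷ 1 ∷ [])) refl refl refl refl
        (suc t ∷ r ∷ s ∷ 0 ∷ [])
        (λ { 0F → refl
           ; 1F → r+0+0
           ; 2F → +-identityʳ s
           ; 3F → refl }))
      unowned
  where
  r+0+0 : r + 0 + 0 ≡ r
  r+0+0 = trans (+-identityʳ _) (+-identityʳ r)
  smallest : (a b c d : Bool) →
             r + 0 + 0 ≡ (if a then t else 0)
                         + ((if b then suc r else 0) + ((if c then s else 0) + ((if d then 0 else 0) + 0))) →
             c ≡ true
  smallest true  b     c    d eq = contradiction r<t (≤⇒≯
    (subst (t ≤_) (trans (sym eq) r+0+0) (m≤m+n t _)))
  smallest false true  c    d eq = contradiction ≤-refl (<⇒≱
    (subst (suc r ≤_) (trans (sym eq) r+0+0) (m≤m+n (suc r) _)))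
  smallest false false true d eq = refl
  smallest false false false true  eq = contradiction (subst (1 ≤_) (trans (sym r+0+0) eq) 1≤r) λ ()
  smallest false false false false eq = contradiction (subst (1 ≤_) (trans (sym r+0+0) eq) 1≤r) λ ()
  largest : (a b c d : Bool) → c ≡ false →
            suc t ≢ (if a then t else 0)
                    + ((if b then suc r else 0) + ((if c then s else 0) + ((if d then 0 else 0) + 0)))
  largest true  true  _ _     refl eq = 
    contradiction 1≤r (<⇒≱ (s≤s (≤-reflexive (m+n≡0⇒m≡0 r (suc-injective (excess-1 t eq))))))
  largest true  false _ true  refl eq = contradiction (excess-1 t eq) λ ()
  largest true  false _ false refl eq = contradiction (excess-1 t eq) λ ()
  largest false true  _ true  refl eq = <⇒≢ r<t (sym (trans (suc-injective eq) (+-identityʳ r)))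
  largest false true  _ false refl eq = <⇒≢ r<t (sym (trans (suc-injective eq) (+-identityʳ r)))
  largest false false _ true  refl ()
  largest false false _ false refl ()
  unowned : ∀ owner → ¬ Owners r s (suc t) (t ∷ suc r ∷ s ∷ 0 ∷ []) owner
  unowned owner size =
    largest (owner 0F ≡ᵇ 2) (owner 1F ≡ᵇ 2) (owner 2F ≡ᵇ 2) (owner 3F ≡ᵇ 2)
      (≡ᵇ-exclusive (owner 2F) (λ ())
        (smallest (owner 0F ≡ᵇ 0) (owner 1F ≡ᵇ 0) (owner 2F ≡ᵇ 0) (owner 3F ≡ᵇ 0) (size 0)))
      (size 2)

-- After the transfer the classes other than `t` have sizes `2 + k`, `2 + k` and 2. One of them is
-- less than `3 + k` and any two exceed it, so both parts of size `3 + k` would have to own the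
-- single class of size `t`.
two-smallest-equal : (k t : ℕ) → ¬ SchurPositive (K₃ (3 + k) (3 + k) t)
two-smallest-equal k t =
  not-Schur-positive-if (3 + k) (3 + k) t (2 + k) (1 + k) (t ∷ 2 ∷ []) (n≤1+n (1 + k))
      (blocks-colouring (3 + k) 2 (1 + k) t 0F 3F 1F 2F
        (lookup (0 ∷ 1 ∷ 2 ∷ 1 ∷ [])) refl refl refl refl
        (3 + k ∷ 1 + k ∷ t ∷ 2 ∷ [])
        (λ { 0F → trans (+-identityʳ _) (+-identityʳ (3 + k))
           ; 1F → +-identityʳ (1 + k)
           ; 2F → refl
           ; 3F → refl }))
      unowned
  where
  contains-t : (a b c d : Bool) →
               3 + k ≡ (if a then 2 + k else 0)
                       + ((if b then 2 + k else 0) + ((if c then t else 0) + ((if d then 2 else 0) + 0))) →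
               c ≡ true
  contains-t _     _     true  _     eq = refl
  contains-t true  true  false _     eq = contradiction (excess-1 (2 + k) eq) λ ()
  contains-t true  false false true  eq = contradiction (excess-1 (2 + k) eq) λ ()
  contains-t true  false false false eq = contradiction (excess-1 (2 + k) eq) λ ()
  contains-t false true  false true  eq = contradiction (excess-1 (2 + k) eq) λ ()
  contains-t false true  false false eq = contradiction (excess-1 (2 + k) eq) λ ()
  contains-t false false false true  ()
  contains-t false false false false ()
  unowned : ∀ owner → ¬ Owners (3 + k) (3 + k) t (2 + k ∷ 2 + k ∷ t ∷ 2 ∷ []) owner
  unowned owner size = contradiction
    (trans (sym (contains-t (owner 0F ≡ᵇ 1) (owner 1F ≡ᵇ 1) (owner 2F ≡ᵇ 1) (owner 3F ≡ᵇ 1)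
                 (trans (sym (+-identityʳ (3 + k))) (size 1))))
      (≡ᵇ-exclusive (owner 2F) {0} {1} (λ ())
        (contains-t (owner 0F ≡ᵇ 0) (owner 1F ≡ᵇ 0) (owner 2F ≡ᵇ 0) (owner 3F ≡ᵇ 0)
                   (trans (sym (trans (+-identityʳ _) (+-identityʳ (3 + k)))) (size 0)))))
    λ ()

-- After the transfer the classes have sizes `2 + k`, 2, `2 + k` and `2 + k`. A single class is
-- smaller than `3 + k` and any two together are larger, so no group of classes makes up the second
-- part.
two-largest-equal : (k : ℕ) → ¬ SchurPositive (K₃ (2 + k) (3 + k) (3 + k))
two-largest-equal k =
  not-Schur-positive-if (2 + k) (3 + k) (3 + k) (2 + k) 1 (2 + k ∷ 2 + k ∷ []) (s≤s z≤n)
      (blocks-colouring (2 + k) 1 (2 + k) (3 + k) 2F 1F 3F 0F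
        (lookup (2 ∷ 1 ∷ 0 ∷ 1 ∷ [])) refl refl refl refl
        (3 + k ∷ 1 ∷ 2 + k ∷ 2 + k ∷ [])
        (λ { 0F → refl
           ; 1F → refl
           ; 2F → trans (+-identityʳ _) (+-identityʳ (2 + k))
           ; 3F → +-identityʳ (2 + k) }))
      unowned
  where
  impossible : (a b c d : Bool) →
               3 + k ≢ (if a then 2 + k else 0)
                       + ((if b then 2 else 0) + ((if c then 2 + k else 0) + ((if d then 2 + k else 0) + 0)))
  impossible true  true  _     _     eq = contradiction (excess-1 (2 + k) eq) λ ()
  impossible true  false true  _     eq = contradiction (excess-1 (2 + k) eq) λ ()
  impossible true  false false true  eq = contradiction (excess-1 (2 + k) eq) λ ()
  impossible true  false false false eq = contradiction (excess-1 (2 + k) eq) λ ()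
  -- Already `2 + (2 + k)` exceeds `3 + k`; cancelling three successors leaves `k` equal to
  -- something larger than `k`.
  impossible false true  true  _     eq = m≢1+m+n k (suc-injective (suc-injective (suc-injective eq)))
  impossible false true  false true  eq = m≢1+m+n k (suc-injective (suc-injective (suc-injective eq)))
  impossible false true  false false ()
  impossible false false true  true  eq = contradiction (excess-1 (2 + k) eq) λ ()
  impossible false false true  false eq = contradiction (excess-1 (2 + k) eq) λ ()
  impossible false false false true  eq = contradiction (excess-1 (2 + k) eq) λ ()
  impossible false false false false ()
  unowned : ∀ owner → ¬ Owners (2 + k) (3 + k) (3 + k) (2 + k ∷ 2 ∷ 2 + k ∷ 2 + k ∷ []) owner
  unowned owner size =
    impossible (owner 0F ≡ᵇ 1) (owner 1F ≡ᵇ 1) (owner 2F ≡ᵇ 1) (owner 3F ≡ᵇ 1)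
      (trans (sym (+-identityʳ (3 + k))) (size 1))

-- If `r < s < t`, the gap from `r` to `t` is at least 2. If `r < s` and `s = t`, either the gap is
-- at least 2 or `s = r + 1`. If `r = s`, then `r ≥ 3` is the family of two equal smallest parts,
-- and for `r ≤ 2` the graph is exceptional or the gap is again at least 2.
not-Schur-positive : (r s t : ℕ) → 1 ≤ r → r ≤ s → s ≤ t → ¬ Exceptional r s t →
                     ¬ SchurPositive (K₃ r s t)
not-Schur-positive r s t 1≤r r≤s s≤t ordinary with m≤n⇒m<n∨m≡n r≤s | m≤n⇒m<n∨m≡n s≤t
not-Schur-positive r s (suc t) 1≤r r≤s s≤t ordinary | inj₁ r<s | inj₁ (s≤s s≤t′) =
  far-apart r s t 1≤r (<-≤-trans r<s s≤t′)
not-Schur-positive r (suc s) _ 1≤r r≤s s≤t ordinary | inj₁ (s≤s r≤s′) | inj₂ refl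
  with m≤n⇒m<n∨m≡n r≤s′
... | inj₁ r<s = far-apart r (suc s) s 1≤r r<s
not-Schur-positive (suc zero) _ _ 1≤r r≤s s≤t ordinary | inj₁ _ | inj₂ refl | inj₂ refl =
  contradiction e122 ordinary
not-Schur-positive (suc (suc k)) _ _ 1≤r r≤s s≤t ordinary | inj₁ _ | inj₂ refl | inj₂ refl =
  two-largest-equal k
not-Schur-positive (suc (suc (suc k))) _ t 1≤r r≤s s≤t ordinary | inj₂ refl | _ = two-smallest-equal k t
not-Schur-positive 1 _ _ 1≤r r≤s s≤t ordinary | inj₂ refl | inj₂ refl = contradiction e111 ordinary
not-Schur-positive 2 _ _ 1≤r r≤s s≤t ordinary | inj₂ refl | inj₂ refl = contradiction e222 ordinary
not-Schur-positive 1 _ 2 1≤r r≤s s≤t ordinary | inj₂ refl | inj₁ _ = contradiction e112 ordinary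
not-Schur-positive 2 _ 3 1≤r r≤s s≤t ordinary | inj₂ refl | inj₁ _ = contradiction e223 ordinary
not-Schur-positive 1 _ 1 1≤r r≤s s≤t ordinary | inj₂ refl | inj₁ (s≤s ())
not-Schur-positive 2 _ 2 1≤r r≤s s≤t ordinary | inj₂ refl | inj₁ (s≤s (s≤s ()))
not-Schur-positive 2 _ 1 1≤r r≤s s≤t ordinary | inj₂ refl | inj₁ (s≤s ())
not-Schur-positive 1 _ (suc (suc (suc t))) 1≤r r≤s s≤t ordinary | inj₂ refl | inj₁ _ =
  far-apart 1 1 (2 + t) 1≤r (s≤s (s≤s z≤n))
not-Schur-positive 2 _ (suc (suc (suc (suc t)))) 1≤r r≤s s≤t ordinary | inj₂ refl | inj₁ _ =
  far-apart 2 2 (3 + t) 1≤r (s≤s (s≤s (s≤s z≤n)))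

-- Counting proper colourings vertex by vertex

-- For one colour: the part using it so far, and the number of vertices still to be coloured with it.
Slot : Set
Slot = Maybe ℕ × ℕ

accepts : ℕ → Slot → Bool
accepts p (_       , zero)  = false
accepts p (nothing , suc _) = true
accepts p (just q  , suc _) = p ≡ᵇ q

-- The result matters only for slots that `accepts` admits, where the number is a successor and
-- `pred` is a true subtraction.
occupy : ℕ → Slot → Slot
occupy p (_ , k) = just p , pred k

exhausted : Vec Slot m → Bool
exhausted []                 = true
exhausted ((_ , zero)  ∷ st) = exhausted st
exhausted ((_ , suc _) ∷ st) = false

-- The slots hold all that later vertices must know of earlier ones, so properness and content are
-- checked in one pass, without comparing pairs of vertices.
run : (Fin n → ℕ) → Vec Slot m → Vec (Fin m) n → Bool
run P st []      = exhausted st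
run P st (c ∷ κ) = accepts (P zero) (lookup st c) ∧ run (P ∘ suc) (updateAt st c (occupy (P zero))) κ

Fits : ℕ → Maybe ℕ → Set
Fits p nothing  = ⊤
Fits p (just q) = p ≡ q

-- The invariant of `run` in mid-course: the remaining vertices are coloured compatibly among
-- themselves, use up what the slots have left, and respect the parts that already claim a colour.
Admissible : (Fin n → ℕ) → Vec Slot m → Vec (Fin m) n → Set
Admissible P st κ = Compatible P κ
                  × (∀ c → occurrences κ c ≡ proj₂ (lookup st c))
                  × (∀ i → Fits (P i) (proj₁ (lookup st (lookup κ i))))

accepts⇔ : (p : ℕ) (s : Slot) → T (accepts p s) ⇔ (Fits p (proj₁ s) × 1 ≤ proj₂ s)
accepts⇔ p (tag     , zero)  = mk⇔ ⊥-elim λ ()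
accepts⇔ p (nothing , suc _) = mk⇔ (λ _ → tt , s≤s z≤n) (λ _ → tt)
accepts⇔ p (just q  , suc _) = mk⇔ (λ t → ≡ᵇ⇒≡ p q t , s≤s z≤n) (λ (p≡q , _) → ≡⇒≡ᵇ p q p≡q)

exhausted⇔ : (st : Vec Slot m) → T (exhausted st) ⇔ (∀ c → 0 ≡ proj₂ (lookup st c))
exhausted⇔ []                 = mk⇔ (λ _ ()) (λ _ → tt)
exhausted⇔ ((_ , zero)  ∷ st) = mk⇔ (λ { t zero → refl ; t (suc c) → to (exhausted⇔ st) t c })
                                    (λ h → from (exhausted⇔ st) (h ∘ suc))
exhausted⇔ ((_ , suc _) ∷ st) = mk⇔ ⊥-elim (λ h → contradiction (h zero) λ ())

-- Colouring the first vertex tags the slot of `c` with its part; for the later vertices, fitting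
-- this tag is the same as compatibility with the first vertex.
admissible-∷ : (P : Fin (suc n) → ℕ) (st : Vec Slot m) (c : Fin m) (κ : Vec (Fin m) n) →
               (T (accepts (P zero) (lookup st c))
                 × Admissible (P ∘ suc) (updateAt st c (occupy (P zero))) κ)
               ⇔ Admissible P st (c ∷ κ)
admissible-∷ {n} {m} P st c κ = mk⇔ extend restrict
  where
  p   = P zero
  st′ = updateAt st c (occupy p)
  at-c : lookup st′ c ≡ occupy p (lookup st c)
  at-c = lookup∘updateAt c st
  elsewhere : ∀ {d} → d ≢ c → lookup st′ d ≡ lookup st d
  elsewhere {d} d≢c = lookup∘updateAt′ d c d≢c st

  extend : T (accepts p (lookup st c)) × Admissible (P ∘ suc) st′ κ → Admissible P st (c ∷ κ)
  extend (acc , compatible , content , fits) = compatible′ , content′ , fits′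
    where
    fits-c  = proj₁ (to (accepts⇔ p (lookup st c)) acc)
    nonzero = proj₂ (to (accepts⇔ p (lookup st c)) acc)
    same-part : ∀ i → lookup κ i ≡ c → P (suc i) ≡ p
    same-part i κi≡c = subst (λ s → Fits (P (suc i)) (proj₁ s))
                             (trans (cong (lookup st′) κi≡c) at-c) (fits i)
    compatible′ : Compatible P (c ∷ κ)
    compatible′ zero    zero    _     = refl
    compatible′ zero    (suc j) c≡κj  = sym (same-part j (sym c≡κj))
    compatible′ (suc i) zero    κi≡c  = same-part i κi≡c
    compatible′ (suc i) (suc j) κi≡κj = compatible i j κi≡κj
    content′ : ∀ d → occurrences (c ∷ κ) d ≡ proj₂ (lookup st d)
    content′ d with d ≟F c
    ... | yes refl rewrite ==F-refl c =
      trans (cong suc (trans (content c) (cong proj₂ at-c))) (suc-pred-≤ nonzero)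
      where
      suc-pred-≤ : ∀ {k} → 1 ≤ k → suc (pred k) ≡ k
      suc-pred-≤ (s≤s _) = refl
    ... | no  d≢c  rewrite ==F-≢ (d≢c ∘ sym) = trans (content d) (cong proj₂ (elsewhere d≢c))
    fits′ : ∀ i → Fits (P i) (proj₁ (lookup st (lookup (c ∷ κ) i)))
    fits′ zero    = fits-c
    fits′ (suc i) with lookup κ i ≟F c
    ... | yes κi≡c = subst₂ (λ x d → Fits x (proj₁ (lookup st d))) (sym (same-part i κi≡c)) (sym κi≡c) fits-c
    ... | no  κi≢c = subst (λ s → Fits (P (suc i)) (proj₁ s)) (elsewhere κi≢c) (fits i)

  restrict : Admissible P st (c ∷ κ) → T (accepts p (lookup st c)) × Admissible (P ∘ suc) st′ κ
  restrict (compatible , content , fits) =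
    from (accepts⇔ p (lookup st c)) (fits zero , subst (1 ≤_) content-c (s≤s z≤n)) ,
    (λ i j → compatible (suc i) (suc j)) , content′ , fits′
    where
    content-c : suc (occurrences κ c) ≡ proj₂ (lookup st c)
    content-c = trans (cong (λ b → ⟦ b ⟧ + occurrences κ c) (sym (==F-refl c))) (content c)
    content′ : ∀ d → occurrences κ d ≡ proj₂ (lookup st′ d)
    content′ d with d ≟F c
    ... | yes refl = trans (cong pred content-c) (cong proj₂ (sym at-c))
    ... | no  d≢c  = trans
      (trans (cong (λ b → ⟦ b ⟧ + occurrences κ d) (sym (==F-≢ (d≢c ∘ sym)))) (content d))
      (cong proj₂ (sym (elsewhere d≢c)))
    fits′ : ∀ i → Fits (P (suc i)) (proj₁ (lookup st′ (lookup κ i)))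
    fits′ i with lookup κ i ≟F c
    ... | yes κi≡c = subst (λ s → Fits (P (suc i)) (proj₁ s)) (sym (trans (cong (lookup st′) κi≡c) at-c))
                           (compatible (suc i) zero κi≡c)
    ... | no  κi≢c = subst (λ s → Fits (P (suc i)) (proj₁ s)) (sym (elsewhere κi≢c)) (fits (suc i))

run⇔ : (P : Fin n → ℕ) (st : Vec Slot m) (κ : Vec (Fin m) n) → T (run P st κ) ⇔ Admissible P st κ
run⇔ P st [] = mk⇔
  (λ t → (λ ()) , to (exhausted⇔ st) t , (λ ()))
  (λ (_ , content , _) → from (exhausted⇔ st) content)
run⇔ P st (c ∷ κ) = mk⇔
  (λ t → let acc , rest = to (T-∧ {accepts (P zero) (lookup st c)}) t
         in to (admissible-∷ P st c κ) (acc , to (run⇔ (P ∘ suc) _ κ) rest))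
  (λ a → let acc , rest = from (admissible-∷ P st c κ) a
         in from (T-∧ {accepts (P zero) (lookup st c)}) (acc , from (run⇔ (P ∘ suc) _ κ) rest))

-- The sum over all colours open to a vertex of part `p`. Recursion on the slots, with `f` as
-- continuation, suits both the deletion of full slots and direct evaluation.
pick : ℕ → Vec Slot m → (Vec Slot m → ℕ) → ℕ
pick p []       f = 0
pick p (s ∷ st) f = (if accepts p s then f (occupy p s ∷ st) else 0) + pick p st (f ∘ (s ∷_))

runs : (Fin n → ℕ) → Vec Slot m → ℕ
runs {zero}  P st = ⟦ exhausted st ⟧
runs {suc n} P st = pick (P zero) st (runs (P ∘ suc))

pick-∑ : (p : ℕ) (st : Vec Slot m) (f : Vec Slot m → ℕ) →
         ∑ (λ c → if accepts p (lookup st c) then f (updateAt st c (occupy p)) else 0) ≡ pick p st f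
pick-∑ p []       f = refl
pick-∑ p (s ∷ st) f = cong ((if accepts p s then f (occupy p s ∷ st) else 0) +_) (pick-∑ p st (f ∘ (s ∷_)))

-- A filter over all colourings becomes a search that abandons a branch at the first refused colour.
count-runs : (P : Fin n → ℕ) (st : Vec Slot m) → countᵇ (run P st) (vecsOf (allFin m) n) ≡ runs P st
count-runs {zero}  P st = +-identityʳ _
count-runs {suc n} {m} P st = begin
  countᵇ (run P st) (vecsOf (allFin m) (suc n))
    ≡⟨ count-vecsOf (run P st) (allFin m) ⟩
  sum (map (λ c → countᵇ (λ κ → run P st (c ∷ κ)) (vecsOf (allFin m) n)) (allFin m))
    ≡⟨ sum-tabulate {n = m} (λ c → countᵇ (λ κ → run P st (c ∷ κ)) (vecsOf (allFin m) n)) (λ c → c) ⟩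
  ∑ (λ c → countᵇ (λ κ → run P st (c ∷ κ)) (vecsOf (allFin m) n))
    ≡⟨ ∑-cong (λ c → guard (accepts (P zero) (lookup st c)) _) ⟩
  ∑ (λ c → if accepts (P zero) (lookup st c) then runs (P ∘ suc) (updateAt st c (occupy (P zero))) else 0)
    ≡⟨ pick-∑ (P zero) st (runs (P ∘ suc)) ⟩
  pick (P zero) st (runs (P ∘ suc)) ∎
  where
  open ≡-Reasoning
  guard : ∀ b st′ → countᵇ (λ κ → b ∧ run (P ∘ suc) st′ κ) (vecsOf (allFin m) n)
                    ≡ (if b then runs (P ∘ suc) st′ else 0)
  guard true  st′ = count-runs (P ∘ suc) st′
  guard false st′ = count-false (vecsOf (allFin m) n)

free : Vec ℕ m → Vec Slot m
free = Vec.map (nothing ,_)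

XCoeff≡runs : (P : Fin n → ℕ) (α : Vec ℕ m) → XCoeff (multipartite P) α ≡ runs P (free α)
XCoeff≡runs {n} {m} P α = trans
  (count-cong (λ κ → T-injective (mk⇔
      (λ t → let compatible , content = to (isColouring⇔ P α κ) t
             in from (run⇔ P (free α) κ) (compatible , (λ c → trans (content c) (sym (cong proj₂ (lookup-map c _ α))))
                                        , λ i → subst (λ s → Fits (P i) (proj₁ s)) (sym (lookup-map (lookup κ i) _ α)) tt))
      (λ t → let compatible , content , _ = to (run⇔ P (free α) κ) t
             in from (isColouring⇔ P α κ) (compatible , λ c → trans (content c) (cong proj₂ (lookup-map c _ α))))))
    (vecsOf (allFin m) n))
  (count-runs P (free α))

-- Elementary symmetric functions factor by factor

-- The coefficient at `α` of e_l times the series with coefficients `f`: the sum of `f` over the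
-- vectors got from `α` by lowering `l` distinct positive exponents by 1.
choose : Vec ℕ m → ℕ → (Vec ℕ m → ℕ) → ℕ
choose []          zero    f = f []
choose []          (suc l) f = 0
choose (zero ∷ α)  l       f = choose α l (f ∘ (zero ∷_))
choose (suc k ∷ α) zero    f = choose α zero (f ∘ (suc k ∷_))
choose (suc k ∷ α) (suc l) f = choose α l (f ∘ (k ∷_)) + choose α (suc l) (f ∘ (suc k ∷_))

choose-cong : (α : Vec ℕ m) (l : ℕ) {f g : Vec ℕ m → ℕ} → f ≗ g → choose α l f ≡ choose α l g
choose-cong []          zero    f≗g = f≗g []
choose-cong []          (suc l) f≗g = refl
choose-cong (zero ∷ α)  l       f≗g = choose-cong α l (λ β → f≗g _)
choose-cong (suc k ∷ α) zero    f≗g = choose-cong α zero (λ β → f≗g _)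
choose-cong (suc k ∷ α) (suc l) f≗g =
  cong₂ _+_ (choose-cong α l (λ β → f≗g _)) (choose-cong α (suc l) (λ β → f≗g _))

choose-+ : (α : Vec ℕ m) (l : ℕ) (f g : Vec ℕ m → ℕ) →
           choose α l (λ β → f β + g β) ≡ choose α l f + choose α l g
choose-+ []          zero    f g = refl
choose-+ []          (suc l) f g = refl
choose-+ (zero ∷ α)  l       f g = choose-+ α l _ _
choose-+ (suc k ∷ α) zero    f g = choose-+ α zero _ _
choose-+ (suc k ∷ α) (suc l) f g = trans
  (cong₂ _+_ (choose-+ α l (f ∘ (k ∷_)) (g ∘ (k ∷_)))
             (choose-+ α (suc l) (f ∘ (suc k ∷_)) (g ∘ (suc k ∷_))))
  (interchange +-commutativeSemigroup (choose α l (f ∘ (k ∷_))) _ _ _)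

choose-0 : (α : Vec ℕ m) (l : ℕ) → choose α l (λ _ → 0) ≡ 0
choose-0 []          zero    = refl
choose-0 []          (suc l) = refl
choose-0 (zero ∷ α)  l       = choose-0 α l
choose-0 (suc k ∷ α) zero    = choose-0 α zero
choose-0 (suc k ∷ α) (suc l) = cong₂ _+_ (choose-0 α l) (choose-0 α (suc l))

choose-count : (α : Vec ℕ m) (l : ℕ) (Q : A → Vec ℕ m → Bool) (xs : List A) →
               choose α l (λ β → countᵇ (λ x → Q x β) xs)
               ≡ sum (map (λ x → choose α l (λ β → ⟦ Q x β ⟧)) xs)
choose-count α l Q []       = choose-0 α l
choose-count α l Q (x ∷ xs) = trans
  (choose-+ α l (λ β → ⟦ Q x β ⟧) (λ β → countᵇ (λ x → Q x β) xs))
  (cong (choose α l (λ β → ⟦ Q x β ⟧) +_) (choose-count α l Q xs))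

size : Vec Bool m → ℕ
size S = countᵇ (λ b → b) (Vec.toList S)

choose-guard : (α : Vec ℕ m) (l : ℕ) (b : Bool) (g : Vec ℕ m → Bool) →
               choose α l (λ β → ⟦ b ∧ g β ⟧) ≡ (if b then choose α l (λ β → ⟦ g β ⟧) else 0)
choose-guard α l true  g = refl
choose-guard α l false g = choose-0 α l

subsetsOfSum : (α : Vec ℕ m) (M : Fin m → ℕ) (l : ℕ) → ℕ
subsetsOfSum {m} α M l =
  countᵇ (λ S → (size S ≡ᵇ l) ∧ (tabulate (λ j → b2n (lookup S j) + M j) ==V α))
         (vecsOf (true ∷ false ∷ []) m)

count-guard : (p q : A → Bool) (b : Bool) (xs : List A) →
              countᵇ (λ x → p x ∧ (b ∧ q x)) xs ≡ (if b then countᵇ (λ x → p x ∧ q x) xs else 0)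
count-guard p q true  xs = refl
count-guard p q false xs = trans (count-cong (λ x → ∧-zeroʳ (p x)) xs) (count-false xs)

-- Subtracting the indicator of the subset from `α` turns the condition indicator plus `M` equals
-- `α` into the condition that the lowered vector equals `M`.
subsetsOfSum≡choose : (α : Vec ℕ m) (M : Fin m → ℕ) (l : ℕ) →
                      subsetsOfSum α M l ≡ choose α l (λ β → ⟦ tabulate M ==V β ⟧)
subsetsOfSum≡choose []      M zero    = refl
subsetsOfSum≡choose []      M (suc l) = refl
subsetsOfSum≡choose {suc m} (k ∷ α) M l = trans
  (count-vecsOf (λ S → (size S ≡ᵇ l) ∧ (tabulate (λ j → b2n (lookup S j) + M j) ==V (k ∷ α)))
                (true ∷ false ∷ []))
  (trans (cong₂ _+_ (in-S k l) (trans (+-identityʳ _) (not-in-S k l))) (collect k l))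
  where
  M₀ = M zero
  M′ = M ∘ suc
  Subsets = vecsOf (true ∷ false ∷ []) m
  rest : ℕ → ℕ
  rest l = choose α l (λ β → ⟦ tabulate M′ ==V β ⟧)
  -- The contribution of the subsets that contain the first index; it requires both the exponent
  -- there and the size of the subset to be positive.
  with-first : ℕ → ℕ → ℕ
  with-first zero    l       = 0
  with-first (suc k) zero    = 0
  with-first (suc k) (suc l) = if M₀ ≡ᵇ k then rest l else 0
  guarded : ∀ b l → countᵇ (λ S → (size S ≡ᵇ l) ∧ (b ∧ (tabulate (λ j → b2n (lookup S j) + M′ j) ==V α))) Subsets
                    ≡ (if b then rest l else 0)
  guarded b l = trans (count-guard (λ S → size S ≡ᵇ l) _ b Subsets)
                      (cong (λ x → if b then x else 0) (subsetsOfSum≡choose α M′ l))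
  in-S : ∀ k l → countᵇ (λ S → (suc (size S) ≡ᵇ l)
                               ∧ ((suc M₀ ≡ᵇ k) ∧ (tabulate (λ j → b2n (lookup S j) + M′ j) ==V α))) Subsets
                 ≡ with-first k l
  in-S zero    zero    = count-false Subsets
  in-S zero    (suc l) = guarded false l
  in-S (suc k) zero    = count-false Subsets
  in-S (suc k) (suc l) = guarded (M₀ ≡ᵇ k) l
  not-in-S : ∀ k l → countᵇ (λ S → (size S ≡ᵇ l)
                               ∧ ((M₀ ≡ᵇ k) ∧ (tabulate (λ j → b2n (lookup S j) + M′ j) ==V α))) Subsets
                 ≡ (if M₀ ≡ᵇ k then rest l else 0)
  not-in-S k l = guarded (M₀ ≡ᵇ k) l
  peel : ∀ k l → choose α l (λ β → ⟦ tabulate M ==V (k ∷ β) ⟧) ≡ (if M₀ ≡ᵇ k then rest l else 0)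
  peel k l = choose-guard α l (M₀ ≡ᵇ k) (tabulate M′ ==V_)
  collect : ∀ k l → with-first k l + (if M₀ ≡ᵇ k then rest l else 0)
                    ≡ choose (k ∷ α) l (λ β → ⟦ tabulate M ==V β ⟧)
  collect zero    l       = sym (peel zero l)
  collect (suc k) zero    = sym (peel (suc k) zero)
  collect (suc k) (suc l) = sym (cong₂ _+_ (peel k l) (peel (suc k) (suc l)))

elementary : List ℕ → {m : ℕ} → Vec ℕ m → ℕ
elementary []       α = ⟦ Vec.replicate _ 0 ==V α ⟧
elementary (l ∷ λ′) α = choose α l (elementary λ′)

eCoeff≡elementary : (λ′ : List ℕ) (α : Vec ℕ m) → eCoeff λ′ α ≡ elementary λ′ α
eCoeff≡elementary []       α = trans (+-identityʳ _) (cong (λ v → ⟦ v ==V α ⟧) (tabulate-0 _))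
  where
  tabulate-0 : ∀ m → tabulate {n = m} (λ _ → 0) ≡ Vec.replicate m 0
  tabulate-0 zero    = refl
  tabulate-0 (suc m) = cong (0 ∷_) (tabulate-0 m)
eCoeff≡elementary {m} (l ∷ λ′) α = begin
  countᵇ (λ Ss → multiplicities Ss ==V α) (subsetTuples m (l ∷ λ′))
    ≡⟨ count-product (λ Ss → multiplicities Ss ==V α) _∷_ (subsetsOfSize m l) (subsetTuples m λ′) ⟩
  sum (map (λ Ss → countᵇ (λ S → multiplicities (S ∷ Ss) ==V α) (subsetsOfSize m l)) (subsetTuples m λ′))
    ≡⟨ cong sum (map-cong (λ Ss → trans
         (count-filter (λ S → multiplicities (S ∷ Ss) ==V α) (λ S → size S ≡ᵇ l)
            (vecsOf (true ∷ false ∷ []) m))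
         (subsetsOfSum≡choose α _ l)) (subsetTuples m λ′)) ⟩
  sum (map (λ Ss → choose α l (λ β → ⟦ multiplicities Ss ==V β ⟧)) (subsetTuples m λ′))
    -- Linearity of `choose α l` in its last argument pulls the sum over tuples inside, where it is
    -- `eCoeff λ′`.
    ≡⟨ choose-count α l (λ Ss β → multiplicities Ss ==V β) (subsetTuples m λ′) ⟨
  choose α l (eCoeff λ′)
    ≡⟨ choose-cong α l (eCoeff≡elementary λ′) ⟩
  choose α l (elementary λ′) ∎
  where
  open ≡-Reasoning

-- Reduction to finitely many contents

-- The second vector is the first with some idle entries deleted. Idle entries may also be kept,
-- since lowering an exponent or filling a slot can make an entry idle on both sides.
data Padding {A : Set} (Idle : A → Set) : Vec A m → Vec A n → Set where
  []   : Padding Idle [] []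
  keep : (x : A) {xs : Vec A m} {ys : Vec A n} → Padding Idle xs ys → Padding Idle (x ∷ xs) (x ∷ ys)
  skip : {x : A} {xs : Vec A m} {ys : Vec A n} → Idle x → Padding Idle xs ys → Padding Idle (x ∷ xs) ys

choose-padding : {α : Vec ℕ m} {α′ : Vec ℕ n} {f : Vec ℕ m → ℕ} {f′ : Vec ℕ n → ℕ} (l : ℕ) →
                 Padding (_≡ 0) α α′ → (∀ {β β′} → Padding (_≡ 0) β β′ → f β ≡ f′ β′) →
                 choose α l f ≡ choose α′ l f′
choose-padding zero    []               h = h []
choose-padding (suc l) []               h = refl
choose-padding l       (skip refl pad)  h = choose-padding l pad (h ∘ skip refl)
choose-padding l       (keep zero pad)  h = choose-padding l pad (h ∘ keep zero)
choose-padding zero    (keep (suc k) pad) h = choose-padding zero pad (h ∘ keep (suc k))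
choose-padding (suc l) (keep (suc k) pad) h =
  cong₂ _+_ (choose-padding l pad (h ∘ keep k)) (choose-padding (suc l) pad (h ∘ keep (suc k)))

elementary-padding : (λ′ : List ℕ) {α : Vec ℕ m} {α′ : Vec ℕ n} →
                     Padding (_≡ 0) α α′ → elementary λ′ α ≡ elementary λ′ α′
elementary-padding []       []                 = refl
elementary-padding []       (keep zero pad)    = elementary-padding [] pad
elementary-padding []       (keep (suc k) pad) = refl
elementary-padding []       (skip refl pad)    = elementary-padding [] pad
elementary-padding (l ∷ λ′) pad                = choose-padding l pad (elementary-padding λ′)

Full : Slot → Set
Full s = proj₂ s ≡ 0

-- A full slot accepts no vertex, so its own summand is 0 and it stays full in all the others.
pick-padding : (p : ℕ) {st : Vec Slot m} {st′ : Vec Slot n} {f : Vec Slot m → ℕ} {f′ : Vec Slot n → ℕ} →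
               Padding Full st st′ → (∀ {u u′} → Padding Full u u′ → f u ≡ f′ u′) →
               pick p st f ≡ pick p st′ f′
pick-padding p []                        h = refl
pick-padding p (skip {x = _ , zero} refl pad) h = pick-padding p pad (h ∘ skip refl)
pick-padding p (keep s pad)              h =
  cong₂ _+_ (cong (λ x → if accepts p s then x else 0) (h (keep (occupy p s) pad)))
            (pick-padding p pad (h ∘ keep s))

exhausted-padding : {st : Vec Slot m} {st′ : Vec Slot n} → Padding Full st st′ → exhausted st ≡ exhausted st′
exhausted-padding []                         = refl
exhausted-padding (keep (_ , zero)  pad)     = exhausted-padding pad
exhausted-padding (keep (_ , suc _) pad)     = refl
exhausted-padding (skip {x = _ , zero} refl pad) = exhausted-padding pad

runs-padding : ∀ {k} (P : Fin k → ℕ) {st : Vec Slot m} {st′ : Vec Slot n} →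
               Padding Full st st′ → runs P st ≡ runs P st′
runs-padding {k = zero}  P pad = cong ⟦_⟧ (exhausted-padding pad)
runs-padding {k = suc k} P pad = pick-padding (P zero) pad (runs-padding (P ∘ suc))

free-padding : {α : Vec ℕ m} {α′ : Vec ℕ n} → Padding (_≡ 0) α α′ → Padding Full (free α) (free α′)
free-padding []             = []
free-padding (keep k pad)   = keep (nothing , k) (free-padding pad)
free-padding (skip k≡0 pad) = skip k≡0 (free-padding pad)

strip : Vec ℕ m → List ℕ
strip []          = []
strip (zero ∷ α)  = strip α
strip (suc k ∷ α) = suc k ∷ strip α

strip-padding : (α : Vec ℕ m) → Padding (_≡ 0) α (Vec.fromList (strip α))
strip-padding []          = []
strip-padding (zero ∷ α)  = skip refl (strip-padding α)
strip-padding (suc k ∷ α) = keep (suc k) (strip-padding α)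

bump : List ℕ → List ℕ
bump []      = 1 ∷ []
bump (k ∷ l) = suc k ∷ l

-- A nonempty composition starts with 1 or comes from raising the first entry of a smaller one. The
-- repetitions caused by `bump []` are harmless, as only membership is used.
compositions : ℕ → List (List ℕ)
compositions zero    = [] ∷ []
compositions (suc n) = map (1 ∷_) (compositions n) ++ map bump (compositions n)

∷-compositions : (k : ℕ) {l : List ℕ} → l ∈ compositions n → (suc k ∷ l) ∈ compositions (suc k + n)
∷-compositions zero    l∈ = ∈-++⁺ˡ (∈-map⁺ (1 ∷_) l∈)
∷-compositions {n} (suc k) l∈ = ∈-++⁺ʳ (map (1 ∷_) (compositions (suc (k + n)))) (∈-map⁺ bump (∷-compositions k l∈))

strip-composition : (α : Vec ℕ m) → strip α ∈ compositions (Vec.sum α)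
strip-composition []          = here refl
strip-composition (zero ∷ α)  = strip-composition α
strip-composition (suc k ∷ α) = ∷-compositions k (strip-composition α)

-- Homogeneity: vanishing at contents of the wrong total.

choose-vanish : (α : Vec ℕ m) (l : ℕ) (f : Vec ℕ m → ℕ) →
                (∀ β → l + Vec.sum β ≡ Vec.sum α → f β ≡ 0) → choose α l f ≡ 0
choose-vanish []          zero    f h = h [] refl
choose-vanish []          (suc l) f h = refl
choose-vanish (zero ∷ α)  l       f h = choose-vanish α l _ (λ β → h (zero ∷ β))
choose-vanish (suc k ∷ α) zero    f h =
  choose-vanish α zero _ (λ β eq → h (suc k ∷ β) (cong (suc k +_) eq))
choose-vanish (suc k ∷ α) (suc l) f h = cong₂ _+_
  (choose-vanish α l _ (λ β eq → h (k ∷ β) (cong suc (trans (x∙yz≈y∙xz +-commutativeSemigroup l k _) (cong (k +_) eq)))))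
  (choose-vanish α (suc l) _ (λ β eq →
     h (suc k ∷ β) (trans (x∙yz≈y∙xz +-commutativeSemigroup (suc l) (suc k) _) (cong (suc k +_) eq))))

-- Each factor e_l lowers the total exponent by exactly `l`, and the empty product lives in degree
-- 0.
elementary-vanish : (λ′ : List ℕ) (α : Vec ℕ m) → Vec.sum α ≢ sum λ′ → elementary λ′ α ≡ 0
elementary-vanish []       []          Σ≢ = contradiction refl Σ≢
elementary-vanish []       (zero ∷ α)  Σ≢ = elementary-vanish [] α Σ≢
elementary-vanish []       (suc k ∷ α) Σ≢ = refl
elementary-vanish (l ∷ λ′) α           Σ≢ = choose-vanish α l (elementary λ′) λ β eq →
  elementary-vanish λ′ β (λ Σβ≡ → Σ≢ (trans (sym eq) (cong (l +_) Σβ≡)))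

capacity : Vec Slot m → ℕ
capacity st = Vec.sum (Vec.map proj₂ st)

pick-vanish : (p : ℕ) (st : Vec Slot m) (f : Vec Slot m → ℕ) →
              (∀ u → suc (capacity u) ≡ capacity st → f u ≡ 0) → pick p st f ≡ 0
pick-vanish p []                 f h = refl
pick-vanish p ((tag , zero) ∷ st) f h = pick-vanish p st _ (λ u → h _)
pick-vanish p ((tag , suc k) ∷ st) f h = cong₂ _+_
  (vanish (accepts p (tag , suc k)))
  (pick-vanish p st _ (λ u eq → h _ (trans (cong suc (sym (+-suc k _))) (cong (suc k +_) eq))))
  where
  vanish : ∀ b → (if b then f ((just p , k) ∷ st) else 0) ≡ 0
  vanish true  = h _ refl
  vanish false = refl

-- Every coloured vertex uses up one unit of capacity, and none may be left after `n` vertices.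
runs-vanish : (P : Fin n → ℕ) (st : Vec Slot m) → capacity st ≢ n → runs P st ≡ 0
runs-vanish {zero}  P []                  c≢ = contradiction refl c≢
runs-vanish {zero}  P ((_ , zero) ∷ st)   c≢ = runs-vanish P st c≢
runs-vanish {zero}  P ((_ , suc _) ∷ st)  c≢ = refl
runs-vanish {suc n} P st                  c≢ = pick-vanish (P zero) st (runs (P ∘ suc)) λ u eq →
  runs-vanish (P ∘ suc) u (λ c≡n → c≢ (trans (sym eq) (cong suc c≡n)))

capacity-free : (α : Vec ℕ m) → capacity (free α) ≡ Vec.sum α
capacity-free []      = refl
capacity-free (k ∷ α) = cong (k +_) (capacity-free α)

combCoeff-cong : (L : List (List ℕ × ℕ)) (b b′ : List ℕ → {m : ℕ} → Vec ℕ m → ℕ)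
                 {α : Vec ℕ m} {α′ : Vec ℕ n} → (∀ λ′ → b λ′ α ≡ b′ λ′ α′) →
                 combCoeff L b α ≡ combCoeff L b′ α′
combCoeff-cong []             b b′ h = refl
combCoeff-cong ((λ′ , c) ∷ L) b b′ h = cong₂ _+_ (cong (c *_) (h λ′)) (combCoeff-cong L b b′ h)

combCoeff-vanish : (L : List (List ℕ × ℕ)) (α : Vec ℕ m) → All (λ p → sum (proj₁ p) ≡ n) L →
                   Vec.sum α ≢ n → combCoeff L elementary α ≡ 0
combCoeff-vanish []             α []            Σ≢ = refl
combCoeff-vanish ((λ′ , c) ∷ L) α (refl ∷ sums) Σ≢ = cong₂ _+_
  (trans (cong (c *_) (elementary-vanish λ′ α Σ≢)) (*-zeroʳ c)) (combCoeff-vanish L α sums Σ≢)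

-- Certificates for e-expansions.

isPartition? : (λ′ : List ℕ) → Dec (IsPartition λ′)
isPartition? λ′ = All.all? (1 ≤?_) λ′ ×-dec linked? _≥?_ λ′

-- Agreement is asked only at the finitely many compositions of `n`, which makes the whole condition
-- decidable.
Certified : (Fin n → ℕ) → List (List ℕ × ℕ) → Set
Certified {n} P L =
  All (λ p → IsPartition (proj₁ p)) L
  × All (λ p → sum (proj₁ p) ≡ n) L
  × All (λ l → runs P (free (Vec.fromList l)) ≡ combCoeff L elementary (Vec.fromList l)) (compositions n)

certified? : (P : Fin n → ℕ) (L : List (List ℕ × ℕ)) → Dec (Certified P L)
certified? {n} P L = All.all? (λ p → isPartition? (proj₁ p)) L
                 ×-dec All.all? (λ p → sum (proj₁ p) ≟ n) L
                 ×-dec All.all? (λ l → runs P (free (Vec.fromList l))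
                                       ≟ combCoeff L elementary (Vec.fromList l)) (compositions n)

certified⇒e-positive : (P : Fin n → ℕ) (L : List (List ℕ × ℕ)) → Certified P L → EPositive (multipartite P)
certified⇒e-positive {n} P L (partitions , sums , agree) = L , partitions , coefficient
  where
  open ≡-Reasoning
  compare : (α : Vec ℕ m) → Dec (Vec.sum α ≡ n) → runs P (free α) ≡ combCoeff L elementary α
  compare α (no  Σ≢n)  = trans (runs-vanish P (free α) (Σ≢n ∘ trans (sym (capacity-free α))))
                               (sym (combCoeff-vanish L α sums Σ≢n))
  compare α (yes refl) = begin
    runs P (free α)
      ≡⟨ runs-padding P (free-padding (strip-padding α)) ⟩
    runs P (free (Vec.fromList (strip α)))
      ≡⟨ All.lookup agree (strip-composition α) ⟩
    combCoeff L elementary (Vec.fromList (strip α))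
      ≡⟨ combCoeff-cong L elementary elementary (λ λ′ → elementary-padding λ′ (strip-padding α)) ⟨
    combCoeff L elementary α ∎
  coefficient : (m : ℕ) (α : Vec ℕ m) → XCoeff (multipartite P) α ≡ combCoeff L eCoeff α
  coefficient m α = begin
    XCoeff (multipartite P) α  ≡⟨ XCoeff≡runs P α ⟩
    runs P (free α)            ≡⟨ compare α (Vec.sum α ≟ n) ⟩
    combCoeff L elementary α   ≡⟨ combCoeff-cong L eCoeff elementary (λ λ′ → eCoeff≡elementary λ′ α) ⟨
    combCoeff L eCoeff α       ∎

-- The implicit argument is solved by evaluating `certified?` to `yes`, so each expansion is
-- verified by computation where it is stated.
e-positive : (r s t : ℕ) (L : List (List ℕ × ℕ)) {_ : True (certified? (part r s t) L)} → EPositive (K₃ r s t)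
e-positive r s t L {certificate} = certified⇒e-positive (part r s t) L (toWitness certificate)

theorem3p7 : (EPositive (K₃ 1 1 1) × EPositive (K₃ 1 1 2) × EPositive (K₃ 1 2 2)
    × EPositive (K₃ 2 2 2) × EPositive (K₃ 2 2 3))
    × ((r s t : ℕ) → 1 ≤ r → r ≤ s → s ≤ t → ¬ Exceptional r s t
    → ¬ SchurPositive (K₃ r s t))
theorem3p7 =
  -- Each list is the e-expansion of its graph, as pairs of a partition and its coefficient; the
  -- first one says that the chromatic symmetric function of the triangle is 6 e_3.
  ( e-positive 1 1 1 ((3 ∷ [] , 6) ∷ [])
  , e-positive 1 1 2 ((4 ∷ [] , 16) ∷ (3 ∷ 1 ∷ [] , 2) ∷ [])
  , e-positive 1 2 2 ((5 ∷ [] , 70) ∷ (4 ∷ 1 ∷ [] , 6) ∷ (3 ∷ 2 ∷ [] , 2) ∷ [])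
  , e-positive 2 2 2 ((6 ∷ [] , 384) ∷ (5 ∷ 1 ∷ [] , 36) ∷ (3 ∷ 3 ∷ [] , 6) ∷ [])
  , e-positive 2 2 3 ((7 ∷ [] , 1988) ∷ (6 ∷ 1 ∷ [] , 268) ∷ (5 ∷ 2 ∷ [] , 12) ∷ (5 ∷ 1 ∷ 1 ∷ [] , 12)
                      ∷ (4 ∷ 3 ∷ [] , 4) ∷ (3 ∷ 3 ∷ 1 ∷ [] , 2) ∷ []) )
  , not-Schur-positive
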